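{- The problem MM2, restricted to instances in which $|S_i|=2$ for all $S_i\in\mathcal S$, can be solved (to optimality) in time $O(|\mathcal S|\log|\mathcal S|)$.
   Context: An instance of MM2 consists of a finite set $J$ of jobs, a processing time $p_j\ge 0$ for each $j\in J$, and an explicitly listed collection $\mathcal S=\{S_1,\dots,S_k\}$ of scenarios, each scenario $S_i$ being a subset of $J$ (the number $k=|\mathcal S|$ of scenarios is part of the input). For $S\subseteq J$ write $p(S)=\sum_{j\in S}p_j$. A solution is a partition $(A,\bar A)$ of $J$ (jobs in $A$ go to machine 1 and jobs in $\bar A$ go to machine 2; the same assignment is used in all scenarios; a part may be empty). MM2 asks for a partition minimizing the maximum makespan over the scenarios, $\max_{i=1,\dots,k}\max\{p(A\cap S_i),p(\bar A\cap S_i)\}$.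
   Formalization: The processing times p_j are taken to be nonnegative rational numbers rather than arbitrary nonnegative reals. -}

module Defs where

open import Algebra.Properties.CommutativeMonoid.Sum using (sum)
open import Data.Bool using (Bool; true; false; not; if_then_else_; _∧_)
open import Data.Fin using (Fin; toℕ)
open import Data.Fin.Subset using (Subset; _∩_; ∁; ∣_∣)
open import Data.Fin.Subset.Properties using (_∈?_)
open import Data.List using (List; []; _∷_; allFin; concatMap; filter; foldr; length; map)
import Data.List as List
open import Data.Nat using (ℕ; zero; suc; _+_; _∸_; _<?_; _≟_)
open import Relation.Binary.PropositionalEquality using (_≡_)
open import Data.Rational using (ℚ; 0ℚ; _≤_; _≤?_; _⊔_)
import Data.Rational as ℚ
open import Data.Rational.Properties using (+-0-commutativeMonoid)
open import Data.Vec using (lookup; tabulate)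
open import Relation.Nullary using (does)

------------------------------------------------------------------------
-- The problem MM2

record Instance : Set where
  field
    n         : ℕ
    p         : Fin n → ℚ
    p≥0       : ∀ j → 0ℚ ≤ p j
    scenarios : List (Subset n)

  load : Subset n → ℚ
  load S = sum +-0-commutativeMonoid (λ j → if lookup S j then p j else 0ℚ)

  -- Loads are nonnegative, so starting the maximum at 0ℚ only matters
  -- when there are no scenarios.
  makespan : Subset n → ℚ
  makespan A = foldr _⊔_ 0ℚ
    (map (λ S → load (A ∩ S) ⊔ load (∁ A ∩ S)) scenarios)

  Optimal : Subset n → Set
  Optimal A = ∀ B → makespan A ≤ makespan B

open Instance public

------------------------------------------------------------------------
-- Random access machine
--
-- While-programs over ℕ-valued variables, ℕ-valued arrays and ℚ-valued
-- arrays, each named by a natural number.  A program mentions only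
-- finitely many names, so this is a RAM whose memory is divided into a
-- constant number of segments.  Indices can be added, subtracted and
-- compared, processing times can be added and compared; every such
-- operation and every memory access costs one unit.

infix 9 _[_] _⟦_⟧
infixl 6 _⊕_ _⊖_ _⊞_
infix 5 _≐_ _≺_ _≼_
infixr 4 _and_

data IExp : Set where
  lit     : ℕ → IExp
  var     : ℕ → IExp
  _[_]    : ℕ → IExp → IExp
  _⊕_ _⊖_ : IExp → IExp → IExp

data NExp : Set where
  _⟦_⟧ : ℕ → IExp → NExp
  _⊞_  : NExp → NExp → NExp

data Test : Set where
  _≐_ _≺_ : IExp → IExp → Test
  _≼_     : NExp → NExp → Test
  neg     : Test → Test
  _and_   : Test → Test → Test

infix 3 _≔_ _[_]≔_ _⟦_⟧≔_
infixr 2 _⨾_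

data Program : Set where
  skip    : Program
  _≔_     : ℕ → IExp → Program
  _[_]≔_  : ℕ → IExp → IExp → Program
  _⟦_⟧≔_  : ℕ → IExp → NExp → Program
  _⨾_     : Program → Program → Program
  cond    : Test → Program → Program → Program
  while   : Test → Program → Program

record State : Set where
  constructor state
  field
    vars : ℕ → ℕ
    arrs : ℕ → ℕ → ℕ
    nums : ℕ → ℕ → ℚ

open State public

update : {X : Set} → (ℕ → X) → ℕ → X → ℕ → X
update f i x j = if does (j ≟ i) then x else f j

update₂ : {X : Set} → (ℕ → ℕ → X) → ℕ → ℕ → X → ℕ → ℕ → X
update₂ f a i x = update f a (update (f a) i x)

ival : IExp → State → ℕ
ival (lit m)   s = m
ival (var x)   s = vars s x
ival (a [ e ]) s = arrs s a (ival e s)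
ival (d ⊕ e)   s = ival d s + ival e s
ival (d ⊖ e)   s = ival d s ∸ ival e s

nval : NExp → State → ℚ
nval (a ⟦ e ⟧) s = nums s a (ival e s)
nval (d ⊞ e)   s = nval d s ℚ.+ nval e s

tval : Test → State → Bool
tval (d ≐ e)   s = does (ival d s ≟ ival e s)
tval (d ≺ e)   s = does (ival d s <? ival e s)
tval (d ≼ e)   s = does (nval d s ≤? nval e s)
tval (neg b)   s = not (tval b s)
tval (b and c) s = tval b s ∧ tval c s

icost : IExp → ℕ
icost (lit m)   = 1
icost (var x)   = 1
icost (a [ e ]) = 1 + icost e
icost (d ⊕ e)   = 1 + (icost d + icost e)
icost (d ⊖ e)   = 1 + (icost d + icost e)

ncost : NExp → ℕ
ncost (a ⟦ e ⟧) = 1 + icost e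
ncost (d ⊞ e)   = 1 + (ncost d + ncost e)

tcost : Test → ℕ
tcost (d ≐ e)   = 1 + (icost d + icost e)
tcost (d ≺ e)   = 1 + (icost d + icost e)
tcost (d ≼ e)   = 1 + (ncost d + ncost e)
tcost (neg b)   = 1 + tcost b
tcost (b and c) = 1 + (tcost b + tcost c)

-- c , s ⇓[ t ] s′ : started in s, the program c halts in s′ after t steps.
infix 1 _,_⇓[_]_

data _,_⇓[_]_ : Program → State → ℕ → State → Set where
  ⇓skip : ∀ {s} → skip , s ⇓[ 1 ] s
  ⇓var  : ∀ {x e s} →
          (x ≔ e) , s ⇓[ 1 + icost e ]
            record s { vars = update (vars s) x (ival e s) }
  ⇓arr  : ∀ {a d e s} →
          (a [ d ]≔ e) , s ⇓[ 1 + (icost d + icost e) ]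
            record s { arrs = update₂ (arrs s) a (ival d s) (ival e s) }
  ⇓num  : ∀ {a d e s} →
          (a ⟦ d ⟧≔ e) , s ⇓[ 1 + (icost d + ncost e) ]
            record s { nums = update₂ (nums s) a (ival d s) (nval e s) }
  ⇓seq  : ∀ {c d s s′ s″ t u} →
          c , s ⇓[ t ] s′ → d , s′ ⇓[ u ] s″ →
          (c ⨾ d) , s ⇓[ t + u ] s″
  ⇓cond : ∀ {b c d s s′ t} →
          (if tval b s then c else d) , s ⇓[ t ] s′ →
          cond b c d , s ⇓[ tcost b + t ] s′
  ⇓stop : ∀ {b c s} → tval b s ≡ false →
          while b c , s ⇓[ tcost b ] s
  ⇓loop : ∀ {b c s s′ s″ t u} → tval b s ≡ true →
          c , s ⇓[ t ] s′ → while b c , s′ ⇓[ u ] s″ →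
          while b c , s ⇓[ tcost b + (t + u) ] s″

------------------------------------------------------------------------
-- Input and output conventions

nth : {X : Set} → X → List X → ℕ → X
nth d []       i       = d
nth d (x ∷ xs) zero    = x
nth d (x ∷ xs) (suc i) = nth d xs i

elements : ∀ {n} → Subset n → List ℕ
elements {n} S = map toℕ (filter (_∈? S) (allFin n))

-- Each scenario is written as its size followed by its members.
listing : ∀ {n} → List (Subset n) → List ℕ
listing = concatMap (λ S → ∣ S ∣ ∷ elements S)

-- Variables 0 and 1 hold the numbers of jobs and of scenarios, ℕ-array 0
-- the listing of the scenarios and ℚ-array 0 the processing times; all
-- other memory is initially zero.
input : Instance → State
input I = state v a q
  where
  v : ℕ → ℕ
  v 0 = n I
  v 1 = length (scenarios I)
  v _ = 0

  a : ℕ → ℕ → ℕ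
  a 0 = nth 0 (listing (scenarios I))
  a _ = λ _ → 0

  q : ℕ → ℕ → ℚ
  q 0 = nth 0ℚ (List.tabulate (p I))
  q _ = λ _ → 0ℚ

-- Job j is put on machine 1 iff cell j of ℕ-array 1 is 1.  Cells that
-- were never written are zero, so jobs left untouched by the program are
-- on machine 2; this is why a running time independent of the number of
-- jobs is possible.
output : (I : Instance) → State → Subset (n I)
output I s = tabulate (λ j → does (arrs s 1 (toℕ j) ≟ 1))

{-# OPTIONS --safe #-}
-- View a scenario {u, v} as an edge of weight p u + p v.  It contributes its
-- weight to the makespan if u and v share a machine, and the larger of p u
-- and p v, which no partition avoids, otherwise.  Scan the edges by
-- decreasing weight and build a spanning forest, as in Kruskal's algorithm;
-- its proper 2-colouring is optimal.  Indeed, when an edge closes a cycle, any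
-- partition separating all edges at least as heavy agrees, up to exchanging
-- the sides within a tree, with the colouring of the forest built so far; so
-- if the endpoints have the same colour, no partition separates all these
-- edges, and every makespan is at least the weight of the edge.
--
-- The heaviest edge is extracted from a tournament tree, and the forest is a
-- union-find structure with parities and union by size; each of the k rounds
-- takes O(log k) steps.
module Submission where

open import Defs
open import Algebra.Properties.CommutativeMonoid.Sum using (sum; sum-cong-≗)
open import Data.Bool using (Bool; true; false; not; if_then_else_; _∧_; _xor_)
open import Data.Bool.Properties using (xor-assoc; xor-comm; xor-identityʳ)
open import Data.Empty using (⊥; ⊥-elim)
open import Data.Fin using (Fin; zero; suc; toℕ)
open import Data.Fin.Properties using (toℕ<n)
open import Data.Fin.Subset using (Subset; ∣_∣; _∩_; ∁) renaming (⊥ to ⊥ˢ)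
open import Data.Fin.Subset.Properties using (_∈?_)
open import Data.List using (List; []; _∷_; length)
import Data.List as List
import Data.List.Properties as Listₚ
open import Data.List.Relation.Unary.All using (All; []; _∷_)
open import Data.Nat using (ℕ; zero; suc; _+_; _∸_; _*_; _^_; _≤_; _<_; z≤n; s≤s; s≤s⁻¹; _≟_; _<?_; ⌊_/2⌋; NonZero; >-nonZero)
open import Data.Nat.Induction using (<-rec)
open import Data.Nat.Logarithm using (⌊log₂_⌋; ⌊log₂⌋-mono-≤; ⌊log₂[2^n]⌋≡n)
open import Data.Nat.Properties
open import Data.Product using (Σ-syntax; ∃-syntax; _×_; _,_; proj₁; proj₂)
open import Data.Rational using (ℚ; 0ℚ; _⊔_)
import Data.Rational as ℚ
import Data.Rational.Properties as ℚₚ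
open import Data.Sum using (_⊎_; inj₁; inj₂)
open import Data.Unit using (⊤)
open import Data.Vec using ([]; _∷_; lookup)
open import Data.Vec.Properties using (lookup-map; lookup-zipWith; lookup∘tabulate)
open import Function using (_∘_)
open import Relation.Binary.PropositionalEquality hiding ([_])
open import Relation.Nullary using (Dec; does; yes; no; ¬_; contradiction)
open import Relation.Nullary.Decidable using (dec-true; dec-false)

-- Execution within a time bound

-- The bound depends only on the number k of scenarios, so nothing may be initialised or scanned per
-- job. This dictates the encodings: zeroed memory already is a forest of singletons (pointer 0 is a
-- root, sizes count links), only endpoints of edges are painted, and tree depths are bounded
-- through the number of links, at most k, instead of the number of jobs. Memory is tied to the
-- mathematics by a `Ghost`: the root, parity and depth of each node, which the program never
-- stores. Cycles never appear explicitly: `Forced` expresses every separating colouring by its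
-- values at the roots, and a closing edge with equal hues contradicts the existence of such a
-- colouring directly. Each loop is bounded by an invariant indexed by the number of iterations
-- still allowed. The logarithm enters as L = 2 + ⌊log₂ k⌋, which is at most 3 ⌊log₂ k⌋ once k ≥ 2;
-- for k = 1 the logarithm vanishes, whence the restriction in the final bound.

record Runs (c : Program) (s : State) (T : ℕ) (Q : State → Set) : Set where
  constructor runs
  field
    {time} : ℕ
    {final} : State
    steps : c , s ⇓[ time ] final
    within : time ≤ T
    post : Q final

weaken : ∀ {c s T U Q} → T ≤ U → Runs c s T Q → Runs c s U Q
weaken T≤U (runs e t≤T q) = runs e (≤-trans t≤T T≤U) q

map-post : ∀ {c s T P Q} → (∀ {s′} → P s′ → Q s′) → Runs c s T P → Runs c s T Q
map-post f (runs e t p) = runs e t (f p)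

infixr 2 _then_

_then_ : ∀ {c d s T U P Q} → Runs c s T P → (∀ s′ → P s′ → Runs d s′ U Q) →
         Runs (c ⨾ d) s (T + U) Q
runs e t≤T p then f with f _ p
... | runs e′ u≤U q = runs (⇓seq e e′) (+-mono-≤ t≤T u≤U) q

-- The bounds of the two branches are added instead of maximised; this affects only the constant and
-- keeps all bounds sums.
branch : ∀ {b c d s T U Q} →
         (tval b s ≡ true → Runs c s T Q) → (tval b s ≡ false → Runs d s U Q) →
         Runs (cond b c d) s (tcost b + (T + U)) Q
branch {b} {c} {d} {s} {T} {U} {Q} f g = go (tval b s) refl
  where
  go : ∀ v → tval b s ≡ v → Runs (cond b c d) s (tcost b + (T + U)) Q
  go true eq with f eq
  ... | runs e t≤T q =
    runs (⇓cond (subst (λ v → (if v then c else d) , s ⇓[ _ ] _) (sym eq) e))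
         (+-monoʳ-≤ (tcost b) (≤-trans t≤T (m≤m+n T U))) q
  go false eq with g eq
  ... | runs e t≤U q =
    runs (⇓cond (subst (λ v → (if v then c else d) , s ⇓[ _ ] _) (sym eq) e))
         (+-monoʳ-≤ (tcost b) (≤-trans t≤U (m≤n+m U T))) q

-- The index of `P` is a variant: the guard must fail at 0. It is existential on exit because a loop
-- may stop early.
loop : ∀ {b c T} (P : ℕ → State → Set) →
       (∀ {s} → P 0 s → tval b s ≡ true → ⊥) →
       (∀ {m s} → P (suc m) s → tval b s ≡ true → Runs c s T (P m)) →
       ∀ {m s} → P m s →
       Runs (while b c) s (m * (tcost b + T) + tcost b)
            (λ s′ → tval b s′ ≡ false × ∃[ m′ ] P m′ s′)
loop {b} {c} {T} P stop step {m} {s} = go m s (tval b s) refl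
  where
  go : ∀ m s v → tval b s ≡ v → P m s →
       Runs (while b c) s (m * (tcost b + T) + tcost b)
            (λ s′ → tval b s′ ≡ false × ∃[ m′ ] P m′ s′)
  go m s false eq p = runs (⇓stop eq) (m≤n+m (tcost b) _) (eq , m , p)
  go zero s true eq p = ⊥-elim (stop p eq)
  go (suc m) s true eq p with step p eq
  ... | runs {t} {s′} e t≤T p′ with go m s′ (tval b s′) refl p′
  ... | runs {u} e′ u≤ q = runs (⇓loop eq e e′) bound q
    where
    bound : tcost b + (t + u) ≤ (tcost b + T) + m * (tcost b + T) + tcost b
    bound = begin
      tcost b + (t + u)                              ≡⟨ +-assoc (tcost b) t u ⟨
      tcost b + t + u                                ≤⟨ +-mono-≤ (+-monoʳ-≤ (tcost b) t≤T) u≤ ⟩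
      tcost b + T + (m * (tcost b + T) + tcost b)    ≡⟨ +-assoc (tcost b + T) _ _ ⟨
      tcost b + T + m * (tcost b + T) + tcost b      ∎
      where open ≤-Reasoning

-- On a concrete program without branches and loops this reduces to a product of units, so eta fills
-- it in as an implicit argument.
Straight : Program → Set
Straight skip         = ⊤
Straight (_ ≔ _)      = ⊤
Straight (_ [ _ ]≔ _) = ⊤
Straight (_ ⟦ _ ⟧≔ _) = ⊤
Straight (c ⨾ d)      = Straight c × Straight d
Straight (cond _ _ _) = ⊥
Straight (while _ _)  = ⊥

-- A semantics that computes: after a straight block, most fields of an invariant hold by the proofs
-- they had before it.
exec : Program → State → State
exec skip         s = s
exec (x ≔ e)      s = record s { vars = update (vars s) x (ival e s) }
exec (a [ d ]≔ e) s = record s { arrs = update₂ (arrs s) a (ival d s) (ival e s) }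
exec (a ⟦ d ⟧≔ e) s = record s { nums = update₂ (nums s) a (ival d s) (nval e s) }
exec (c ⨾ d)      s = exec d (exec c s)
exec (cond _ _ _) s = s
exec (while _ _)  s = s

cost : Program → ℕ
cost skip         = 1
cost (x ≔ e)      = 1 + icost e
cost (a [ d ]≔ e) = 1 + (icost d + icost e)
cost (a ⟦ d ⟧≔ e) = 1 + (icost d + ncost e)
cost (c ⨾ d)      = cost c + cost d
cost (cond _ _ _) = 0
cost (while _ _)  = 0

exec-⇓ : ∀ c {s} → Straight c → c , s ⇓[ cost c ] exec c s
exec-⇓ skip         _       = ⇓skip
exec-⇓ (x ≔ e)      _       = ⇓var
exec-⇓ (a [ d ]≔ e) _       = ⇓arr
exec-⇓ (a ⟦ d ⟧≔ e) _       = ⇓num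
exec-⇓ (c ⨾ d)      (p , q) = ⇓seq (exec-⇓ c p) (exec-⇓ d q)

block : ∀ c {s} {Q : State → Set} {p : Straight c} → Q (exec c s) → Runs c s (cost c) Q
block c {p = p} q = runs (exec-⇓ c p) ≤-refl q

seq : ∀ {c d s T U Q} → Runs c s T (λ s′ → Runs d s′ U Q) → Runs (c ⨾ d) s (T + U) Q
seq r = r then λ _ r′ → r′

infixr 2 _▸_

_▸_ : ∀ c {d s U Q} {p : Straight c} → Runs d (exec c s) U Q → Runs (c ⨾ d) s (cost c + U) Q
_▸_ c {s = s} {p = p} r = block c {Q = _≡ exec c s} {p} refl then λ { _ refl → r }

does-true : ∀ {P : Set} (d : Dec P) → does d ≡ true → P
does-true (yes p) _ = p

does-false : ∀ {P : Set} (d : Dec P) → does d ≡ false → ¬ P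
does-false (no ¬p) _ = ¬p

not-true : ∀ {b} → not b ≡ true → b ≡ false
not-true {false} _ = refl

not-false : ∀ {b} → not b ≡ false → b ≡ true
not-false {true} _ = refl

module _ {X : Set} (f : ℕ → X) where

  update-same : ∀ i x → update f i x i ≡ x
  update-same i x rewrite dec-true (i ≟ i) refl = refl

  update-other : ∀ {i j} x → j ≢ i → update f i x j ≡ f j
  update-other {i} {j} x j≢i rewrite dec-false (j ≟ i) j≢i = refl

-- Finite sums

sumTo : ℕ → (ℕ → ℕ) → ℕ
sumTo zero    f = 0
sumTo (suc n) f = sumTo n f + f n

sumTo-cong : ∀ n {f g} → (∀ i → i < n → f i ≡ g i) → sumTo n f ≡ sumTo n g
sumTo-cong zero    eq = refl
sumTo-cong (suc n) eq = cong₂ _+_ (sumTo-cong n (λ i i<n → eq i (m<n⇒m<1+n i<n))) (eq n ≤-refl)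

sumTo-zero : ∀ n {f} → (∀ i → i < n → f i ≡ 0) → sumTo n f ≡ 0
sumTo-zero zero    eq = refl
sumTo-zero (suc n) eq = cong₂ _+_ (sumTo-zero n (λ i i<n → eq i (m<n⇒m<1+n i<n))) (eq n ≤-refl)

sumTo≤ : ∀ n {f} → (∀ i → f i ≤ 1) → sumTo n f ≤ n
sumTo≤ zero    f≤1 = z≤n
sumTo≤ (suc n) f≤1 = ≤-trans (+-mono-≤ (sumTo≤ n f≤1) (f≤1 n)) (≤-reflexive (+-comm n 1))

term≤sumTo : ∀ n {f i} → i < n → f i ≤ sumTo n f
term≤sumTo (suc n) {f} i<1+n with m<1+n⇒m<n∨m≡n i<1+n
... | inj₁ i<n  = ≤-trans (term≤sumTo n i<n) (m≤m+n _ _)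
... | inj₂ refl = m≤n+m _ _

-- One summand is exchanged, stated without subtraction.
sumTo-exchange : ∀ n {f g i} → i < n → (∀ j → j < n → j ≢ i → g j ≡ f j) →
                 sumTo n g + f i ≡ sumTo n f + g i
sumTo-exchange (suc n) {f} {g} {i} i<1+n eq with m<1+n⇒m<n∨m≡n i<1+n
... | inj₂ refl = begin
  sumTo n g + g n + f n   ≡⟨ +-assoc (sumTo n g) _ _ ⟩
  sumTo n g + (g n + f n) ≡⟨ cong₂ _+_ (sumTo-cong n λ j j<n → eq j (m<n⇒m<1+n j<n) (<⇒≢ j<n)) (+-comm (g n) (f n)) ⟩
  sumTo n f + (f n + g n) ≡⟨ +-assoc (sumTo n f) _ _ ⟨
  sumTo n f + f n + g n   ∎
  where open ≡-Reasoning
... | inj₁ i<n = begin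
  sumTo n g + g n + f i   ≡⟨ +-assoc (sumTo n g) _ _ ⟩
  sumTo n g + (g n + f i) ≡⟨ cong (sumTo n g +_) (+-comm (g n) (f i)) ⟩
  sumTo n g + (f i + g n) ≡⟨ +-assoc (sumTo n g) _ _ ⟨
  sumTo n g + f i + g n   ≡⟨ cong₂ _+_ (sumTo-exchange n i<n λ j j<n → eq j (m<n⇒m<1+n j<n)) (eq n ≤-refl (<⇒≢ i<n ∘ sym)) ⟩
  sumTo n f + g i + f n   ≡⟨ +-assoc (sumTo n f) _ _ ⟩
  sumTo n f + (g i + f n) ≡⟨ cong (sumTo n f +_) (+-comm (g i) (f n)) ⟩
  sumTo n f + (f n + g i) ≡⟨ +-assoc (sumTo n f) _ _ ⟨
  sumTo n f + f n + g i   ∎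
  where open ≡-Reasoning

-- Disjoint sets with parities

bit : Bool → ℕ
bit false = 0
bit true  = 1

-- Absolute difference by truncated subtraction. On bits it is exclusive or, for which the machine
-- has no instruction.
distance : ℕ → ℕ → ℕ
distance x y = (x ∸ y) + (y ∸ x)

bit-xor : ∀ x y → distance (bit x) (bit y) ≡ bit (x xor y)
bit-xor false false = refl
bit-xor false true  = refl
bit-xor true  false = refl
bit-xor true  true  = refl

bit-not : ∀ x → 1 ∸ bit x ≡ bit (not x)
bit-not false = refl
bit-not true  = refl

xor-swap : ∀ x y z → x xor (y xor z) ≡ y xor (x xor z)
xor-swap false y     z = refl
xor-swap true  false z = refl
xor-swap true  true  z = refl

xor-cancelˡ : ∀ x {y z} → x xor y ≡ x xor z → y ≡ z
xor-cancelˡ false                 eq = eq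
xor-cancelˡ true  {false} {false} eq = refl
xor-cancelˡ true  {true}  {true}  eq = refl

-- The parent pointer 0 encodes a root and suc y the parent y; flip is the
-- parity of the pointer, and hue the parity of the path to the root.
record Ghost : Set where
  field
    rep   : ℕ → ℕ
    hue   : ℕ → Bool
    depth : ℕ → ℕ

open Ghost

-- Each equation concerns a single pointer. As `depth` drops along pointers, cycles are impossible.
data Node (parent flip : ℕ → ℕ) (G : Ghost) (x : ℕ) : Set where
  root  : parent x ≡ 0 → rep G x ≡ x → hue G x ≡ false → depth G x ≡ 0 → Node parent flip G x
  child : ∀ {y b} → parent x ≡ suc y → flip x ≡ bit b → rep G x ≡ rep G y →
          hue G x ≡ b xor hue G y → depth G x ≡ suc (depth G y) → Node parent flip G x

-- Here size counts the links made in a tree, which is one less than the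
-- number of its nodes, and it is reset at nodes that cease to be roots.
record Forest (n : ℕ) (parent flip size : ℕ → ℕ) (G : Ghost) : Set where
  field
    node     : ∀ x → Node parent flip G x
    rep-root : ∀ x → parent (rep G x) ≡ 0
    rep<     : ∀ {x} → x < n → rep G x < n
    balanced : ∀ x → 2 ^ depth G x ≤ suc (size (rep G x))

  at-root : ∀ {a} → parent a ≡ 0 → rep G a ≡ a × hue G a ≡ false × depth G a ≡ 0
  at-root {a} a-root with node a
  ... | root _ r h d        = r , h , d
  ... | child eq _ _ _ _    with () ← trans (sym eq) a-root

singletons : Ghost
singletons = record { rep = λ x → x ; hue = λ _ → false ; depth = λ _ → 0 }

forest-singletons : ∀ n → Forest n (λ _ → 0) (λ _ → 0) (λ _ → 0) singletons
forest-singletons n = record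
  { node     = λ x → root refl refl refl refl
  ; rep-root = λ x → refl
  ; rep<     = λ x<n → x<n
  ; balanced = λ x → ≤-refl
  }

module Link {n : ℕ} {parent flip size : ℕ → ℕ} {G : Ghost} (F : Forest n parent flip size G)
            {a b : ℕ} (a-root : parent a ≡ 0) (b-root : parent b ≡ 0) (a≢b : a ≢ b) (f : Bool)
            where

  open Forest F

  linked : Ghost
  linked = record
    { rep   = λ x → if does (rep G x ≟ a) then b else rep G x
    ; hue   = λ x → if does (rep G x ≟ a) then f xor hue G x else hue G x
    ; depth = λ x → if does (rep G x ≟ a) then suc (depth G x) else depth G x
    }

  moved : ∀ {x} → rep G x ≡ a →
          rep linked x ≡ b × hue linked x ≡ f xor hue G x × depth linked x ≡ suc (depth G x)
  moved {x} eq rewrite dec-true (rep G x ≟ a) eq = refl , refl , refl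

  kept : ∀ {x} → rep G x ≢ a →
         rep linked x ≡ rep G x × hue linked x ≡ hue G x × depth linked x ≡ depth G x
  kept {x} neq rewrite dec-false (rep G x ≟ a) neq = refl , refl , refl

  b-kept : rep G b ≢ a
  b-kept eq = a≢b (trans (sym eq) (proj₁ (at-root b-root)))

  rep-linked : ∀ x y → rep G x ≡ rep G y → rep linked x ≡ rep linked y
  rep-linked x y eq rewrite eq = refl

  -- A link adds `f` to the hues of a whole tree or leaves the tree alone, so agreement within a
  -- tree never changes. This is what preserves `Settled`.
  hue-linked : ∀ x y → rep G x ≡ rep G y → hue linked x ≡ hue linked y → hue G x ≡ hue G y
  hue-linked x y eq h with rep G x ≟ a
  ... | yes r = xor-cancelˡ f
    (trans (sym (proj₁ (proj₂ (moved r)))) (trans h (proj₁ (proj₂ (moved (trans (sym eq) r))))))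
  ... | no r  =
    trans (sym (proj₁ (proj₂ (kept r)))) (trans h (proj₁ (proj₂ (kept (r ∘ trans eq)))))

  parent′ flip′ size₁ size′ : ℕ → ℕ
  parent′ = update parent a (suc b)
  flip′   = update flip a (bit f)
  size₁   = update size b (suc (size b + size a))
  size′   = update size₁ a 0

  -- Only the pointer of `a` changes. Any other node has the same representative as its parent, so
  -- the two are moved together or kept together.
  node-linked : ∀ x → Node parent′ flip′ linked x
  node-linked x with x ≟ a
  ... | yes refl with moved (proj₁ (at-root a-root)) | kept b-kept | at-root a-root | at-root b-root
  ...   | r , h , d | r′ , h′ , d′ | _ , h₀ , d₀ | r₁ , h₁ , d₁ =
    child {b = f} (update-same parent a _) (update-same flip a _)
          (trans r (sym (trans r′ r₁)))
          (trans h (cong (f xor_) (trans h₀ (sym (trans h′ h₁)))))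
          (trans d (cong suc (trans d₀ (sym (trans d′ d₁)))))
  node-linked x | no x≢a with node x
  ... | root p r h d with kept (λ eq → x≢a (trans (sym r) eq))
  ...   | r′ , h′ , d′ = root (trans (update-other parent _ x≢a) p) (trans r′ r) (trans h′ h) (trans d′ d)
  node-linked x | no x≢a | child {y} {c} p fl r h d with rep G x ≟ a
  ... | yes q with moved q | moved (trans (sym r) q)
  ...   | r₁ , h₁ , d₁ | r₂ , h₂ , d₂ =
    child (trans (update-other parent _ x≢a) p) (trans (update-other flip _ x≢a) fl)
          (rep-linked x y r)
          (trans h₁ (trans (cong (f xor_) h) (trans (xor-swap f c _) (cong (c xor_) (sym h₂)))))
          (trans d₁ (cong suc (trans d (sym d₂))))
  node-linked x | no x≢a | child {y} {c} p fl r h d | no q with kept q | kept (q ∘ trans r)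
  ...   | r₁ , h₁ , d₁ | r₂ , h₂ , d₂ =
    child (trans (update-other parent _ x≢a) p) (trans (update-other flip _ x≢a) fl)
          (rep-linked x y r)
          (trans h₁ (trans h (cong (c xor_) (sym h₂))))
          (trans d₁ (trans d (cong suc (sym d₂))))

  root-linked : ∀ x → parent′ (rep linked x) ≡ 0
  root-linked x with rep G x ≟ a
  ... | yes q rewrite proj₁ (moved q) = trans (update-other parent _ (a≢b ∘ sym)) b-root
  ... | no q  rewrite proj₁ (kept q)  = trans (update-other parent _ q) (rep-root x)

  rep-linked< : b < n → ∀ {x} → x < n → rep linked x < n
  rep-linked< b<n {x} x<n with rep G x ≟ a
  ... | yes q rewrite proj₁ (moved q) = b<n
  ... | no q  rewrite proj₁ (kept q)  = rep< x<n

  size′-b : size′ b ≡ suc (size b + size a)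
  size′-b = trans (update-other size₁ 0 (a≢b ∘ sym)) (update-same size b _)

  -- Union by size: only nodes below `a` get deeper, by one, and since `a` is the smaller root their
  -- tree at least doubles its number of nodes, `suc (size _)`.
  balanced-linked : size a ≤ size b → ∀ x → 2 ^ depth linked x ≤ suc (size′ (rep linked x))
  balanced-linked a≤b x with rep G x ≟ a
  ... | yes q rewrite proj₁ (moved q) | proj₂ (proj₂ (moved q)) | size′-b = begin
    2 * 2 ^ depth G x                      ≤⟨ *-monoʳ-≤ 2 (balanced x) ⟩
    2 * suc (size (rep G x))               ≡⟨ cong (λ r → 2 * suc (size r)) q ⟩
    suc (size a) + (suc (size a) + 0)      ≡⟨ cong (suc (size a) +_) (+-identityʳ _) ⟩
    suc (size a) + suc (size a)            ≤⟨ +-monoˡ-≤ (suc (size a)) (s≤s a≤b) ⟩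
    suc (size b + suc (size a))            ≡⟨ cong suc (+-suc (size b) (size a)) ⟩
    suc (suc (size b + size a))            ∎
    where open ≤-Reasoning
  ... | no q rewrite proj₁ (kept q) | proj₂ (proj₂ (kept q)) with rep G x ≟ b
  ...   | yes r rewrite r | size′-b =
    ≤-trans (balanced x) (≤-trans (≤-reflexive (cong (suc ∘ size) r)) (s≤s (m≤n⇒m≤1+n (m≤m+n _ _))))
  ...   | no r rewrite update-other size₁ 0 q
                     | update-other size (suc (size b + size a)) r = balanced x

  forest-linked : size a ≤ size b → b < n → Forest n parent′ flip′ size′ linked
  forest-linked a≤b b<n = record
    { node     = node-linked
    ; rep-root = root-linked
    ; rep<     = rep-linked< b<n
    ; balanced = balanced-linked a≤b
    }

  -- Because the absorbed root gives up its count, the sum over all nodes is the number of links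
  -- made so far. This ties tree sizes to the number of rounds.
  sum-size′ : a < n → b < n → sumTo n size′ ≡ suc (sumTo n size)
  -- With the old sizes of both roots added to each side, each of the two updates becomes one use of
  -- `sumTo-exchange`.
  sum-size′ a<n b<n = +-cancelʳ-≡ (size b + size a) _ _ (begin
    sumTo n size′ + (size b + size a)          ≡⟨ cong (sumTo n size′ +_) (+-comm (size b) (size a)) ⟩
    sumTo n size′ + (size a + size b)          ≡⟨ +-assoc (sumTo n size′) _ _ ⟨
    sumTo n size′ + size a + size b            ≡⟨ cong (λ z → sumTo n size′ + z + size b) (update-other size _ a≢b) ⟨
    sumTo n size′ + size₁ a + size b           ≡⟨ cong (_+ size b) (sumTo-exchange n a<n λ j _ j≢a → update-other size₁ 0 j≢a) ⟩
    sumTo n size₁ + size′ a + size b           ≡⟨ cong (λ z → sumTo n size₁ + z + size b) (update-same size₁ a 0) ⟩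
    sumTo n size₁ + 0 + size b                 ≡⟨ cong (_+ size b) (+-identityʳ _) ⟩
    sumTo n size₁ + size b                     ≡⟨ sumTo-exchange n b<n (λ j _ j≢b → update-other size _ j≢b) ⟩
    sumTo n size + size₁ b                     ≡⟨ cong (sumTo n size +_) (update-same size b _) ⟩
    sumTo n size + suc (size b + size a)       ≡⟨ +-suc (sumTo n size) _ ⟩
    suc (sumTo n size) + (size b + size a)     ∎)
    where open ≡-Reasoning

-- Kruskal's invariant

-- Its sum over the leaves is the potential that the rounds drive down to 0.
positive : ℚ → ℕ
positive q = if does (q ℚ.≤? 0ℚ) then 0 else 1

positive≤1 : ∀ q → positive q ≤ 1
positive≤1 q with does (q ℚ.≤? 0ℚ)
... | true  = z≤n
... | false = ≤-refl

positive-≤0 : ∀ {q} → q ℚ.≤ 0ℚ → positive q ≡ 0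
positive-≤0 {q} q≤0 rewrite dec-true (q ℚ.≤? 0ℚ) q≤0 = refl

positive-0 : ∀ {q} → positive q ≡ 0 → q ℚ.≤ 0ℚ
positive-0 {q} eq = go (q ℚ.≤? 0ℚ) eq
  where
  go : (d : Dec (q ℚ.≤ 0ℚ)) → (if does d then 0 else 1) ≡ 0 → q ℚ.≤ 0ℚ
  go (yes q≤0) _ = q≤0

positive-1 : ∀ {q} → ¬ q ℚ.≤ 0ℚ → positive q ≡ 1
positive-1 {q} q≰0 rewrite dec-false (q ℚ.≤? 0ℚ) q≰0 = refl

-- Over the field of two elements the hypothesis reads p + x + q + y = 1; it is solved for p. Here x
-- and y are the hues of the endpoints, p and q the colours of their roots.
joining-parity : ∀ x y p q → p xor x ≢ q xor y → p ≡ q xor not (y xor x)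
joining-parity false false false false ne = contradiction refl ne
joining-parity false false false true  ne = refl
joining-parity false false true  false ne = refl
joining-parity false false true  true  ne = contradiction refl ne
joining-parity false true  false false ne = refl
joining-parity false true  false true  ne = contradiction refl ne
joining-parity false true  true  false ne = contradiction refl ne
joining-parity false true  true  true  ne = refl
joining-parity true  false false false ne = refl
joining-parity true  false false true  ne = contradiction refl ne
joining-parity true  false true  false ne = contradiction refl ne
joining-parity true  false true  true  ne = refl
joining-parity true  true  false false ne = contradiction refl ne
joining-parity true  true  false true  ne = refl
joining-parity true  true  true  false ne = refl
joining-parity true  true  true  true  ne = contradiction refl ne

-- The chosen parity gives the endpoints of a linking edge different hues.
parity-joined : ∀ x y → not (y xor x) xor x ≢ y
parity-joined false false ()
parity-joined false true  ()
parity-joined true  false ()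
parity-joined true  true  ()

module Edges (n k : ℕ) (U V : ℕ → ℕ) (weight : ℕ → ℚ)
             (U<n : ∀ {i} → i < k → U i < n) (V<n : ∀ {i} → i < k → V i < n)
             (weight≥0 : ∀ {i} → i < k → 0ℚ ℚ.≤ weight i) where

  Separates : (ℕ → Bool) → ℚ → Set
  Separates β θ = ∀ i → i < k → θ ℚ.≤ weight i → β (U i) ≢ β (V i)

  -- Lowering the threshold asks more of the colouring, so this persists while the scan moves on to
  -- lighter edges.
  Forced : Ghost → ℚ → Set
  Forced G θ = ∀ β → Separates β θ → ∀ x → β x ≡ β (rep G x) xor hue G x

  -- A certificate that survives later links. For an edge with equal hues it carries the obstruction
  -- that makes the weight a lower bound on every makespan.
  Settled : Ghost → ℕ → Set
  Settled G i = rep G (U i) ≡ rep G (V i) ×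
                (hue G (U i) ≡ hue G (V i) → ∀ β → ¬ Separates β (weight i))

  -- An extracted leaf is reset to 0 instead of being removed.  If it is
  -- extracted again, its endpoints are already connected and the round changes
  -- nothing.  After k rounds no positive leaf
  -- is left, and weight 0 edges are irrelevant to the makespan.
  record Progress (m : ℕ) (parent flip size : ℕ → ℕ) (T : ℕ → ℚ) (G : Ghost) : Set where
    field
      forest    : Forest n parent flip size G
      leaf      : ∀ {i} → i < k → T (k + i) ≡ weight i ⊎ T (k + i) ≡ 0ℚ × Settled G i
      forced    : ∀ {i} → i < k → Forced G (T (k + i))
      remaining : sumTo k (λ i → positive (T (k + i))) ≤ m
      budget    : sumTo n size + m ≤ k

  module Step {m : ℕ} {parent flip size : ℕ → ℕ} {T T′ : ℕ → ℚ} {G : Ghost}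
           (P : Progress (suc m) parent flip size T G)
           {i : ℕ} (i<k : i < k) (top : ∀ {j} → j < k → T (k + j) ℚ.≤ T (k + i))
           (erased : T′ (k + i) ≡ 0ℚ)
           (others : ∀ {j} → j < k → j ≢ i → T′ (k + j) ≡ T (k + j)) where

    open Progress P
    open Forest forest

    leaf≥0 : 0ℚ ℚ.≤ T (k + i)
    leaf≥0 with leaf i<k
    ... | inj₁ eq       = ℚₚ.≤-trans (weight≥0 i<k) (ℚₚ.≤-reflexive (sym eq))
    ... | inj₂ (eq , _) = ℚₚ.≤-reflexive (sym eq)

    -- If the maximum is not positive, no leaf is, and the count is 0 whatever `m` is. Otherwise
    -- erasing the maximum lowers the count by one.
    remaining′ : sumTo k (λ j → positive (T′ (k + j))) ≤ m
    remaining′ with T (k + i) ℚ.≤? 0ℚ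
    ... | yes ≤0 = ≤-trans (≤-reflexive (sumTo-zero k all-zero)) z≤n
      where
      all-zero : ∀ j → j < k → positive (T′ (k + j)) ≡ 0
      all-zero j j<k with j ≟ i
      ... | yes refl = positive-≤0 (ℚₚ.≤-reflexive erased)
      ... | no j≢i   = positive-≤0 (ℚₚ.≤-trans (ℚₚ.≤-reflexive (others j<k j≢i)) (ℚₚ.≤-trans (top j<k) ≤0))
    ... | no ≰0 = s≤s⁻¹ (begin
      suc (sumTo k (λ j → positive (T′ (k + j))))                    ≡⟨ +-comm _ 1 ⟨
      sumTo k (λ j → positive (T′ (k + j))) + 1                      ≡⟨ cong (_ +_) (positive-1 ≰0) ⟨
      sumTo k (λ j → positive (T′ (k + j))) + positive (T (k + i))   ≡⟨ sumTo-exchange k i<k (λ j j<k j≢i → cong positive (others j<k j≢i)) ⟩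
      sumTo k (λ j → positive (T (k + j))) + positive (T′ (k + i))   ≡⟨ cong (_ +_) (positive-≤0 (ℚₚ.≤-reflexive erased)) ⟩
      sumTo k (λ j → positive (T (k + j))) + 0                       ≡⟨ +-identityʳ _ ⟩
      sumTo k (λ j → positive (T (k + j)))                           ≤⟨ remaining ⟩
      suc m                                                          ∎)
      where open ≤-Reasoning

    -- Shared by skipping and by both directions of linking. `Forced` at the extracted weight
    -- suffices, since no leaf of the new tree exceeds it.
    advance : ∀ {parent′ flip′ size′ G′} → Forest n parent′ flip′ size′ G′ →
              sumTo n size′ ≤ suc (sumTo n size) → Forced G′ (T (k + i)) →
              (∀ {j} → Settled G j → Settled G′ j) → Settled G′ i →
              Progress m parent′ flip′ size′ T′ G′
    advance {size′ = size′} {G′} forest′ grown forced′ preserved new = record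
      { forest    = forest′
      ; leaf      = leaf′
      ; forced    = forced″
      ; remaining = remaining′
      ; budget    = ≤-trans (+-monoˡ-≤ m grown) (≤-trans (≤-reflexive (sym (+-suc (sumTo n size) m))) budget)
      }
      where
      leaf′ : ∀ {j} → j < k → T′ (k + j) ≡ weight j ⊎ T′ (k + j) ≡ 0ℚ × Settled G′ j
      leaf′ {j} j<k with j ≟ i
      ... | yes refl = inj₂ (erased , new)
      ... | no j≢i with leaf j<k
      ...   | inj₁ eq       = inj₁ (trans (others j<k j≢i) eq)
      ...   | inj₂ (eq , s) = inj₂ (trans (others j<k j≢i) eq , preserved s)
      T′≤ : ∀ {j} → j < k → T′ (k + j) ℚ.≤ T (k + i)
      T′≤ {j} j<k with j ≟ i
      ... | yes refl = ℚₚ.≤-trans (ℚₚ.≤-reflexive erased) leaf≥0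
      ... | no j≢i   = ℚₚ.≤-trans (ℚₚ.≤-reflexive (others j<k j≢i)) (top j<k)
      forced″ : ∀ {j} → j < k → Forced G′ (T′ (k + j))
      forced″ j<k β sep = forced′ β (λ e e<k θ≤ → sep e e<k (ℚₚ.≤-trans (T′≤ j<k) θ≤))

    -- An edge closing an odd cycle is as light as any edge of the cycle.
    skip-edge : rep G (U i) ≡ rep G (V i) → Progress m parent flip size T′ G
    skip-edge same = advance forest (n≤1+n _) (forced i<k) (λ s → s) settled
      where
      settled : Settled G i
      settled with leaf i<k
      ... | inj₂ (_ , s) = s
      ... | inj₁ eq      = same , λ h β sep →
        let f = forced i<k β (subst (Separates β) (sym eq) sep) in
        sep i i<k ℚₚ.≤-refl
          (trans (f (U i)) (trans (cong₂ (λ r c → β r xor c) same h) (sym (f (V i)))))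

    -- Erased leaves have connected endpoints, so this leaf is still intact and its value is the
    -- true weight of the edge.
    unsettled-weight : rep G (U i) ≢ rep G (V i) → T (k + i) ≡ weight i
    unsettled-weight distinct with leaf i<k
    ... | inj₁ eq            = eq
    ... | inj₂ (_ , eq , _)  = contradiction eq distinct

    -- The parity of the new pointer between the two roots for which the endpoints end up with
    -- opposite hues.
    join : Bool
    join = not (hue G (V i) xor hue G (U i))

    module _ (distinct : rep G (U i) ≢ rep G (V i)) where

      joined : ∀ β → Separates β (T (k + i)) → β (rep G (U i)) ≡ β (rep G (V i)) xor join
      joined β sep = joining-parity (hue G (U i)) (hue G (V i)) (β (rep G (U i))) (β (rep G (V i))) λ eq →
        sep i i<k (ℚₚ.≤-reflexive (unsettled-weight distinct))
          (trans (forced i<k β sep (U i)) (trans eq (sym (forced i<k β sep (V i)))))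

      joined′ : ∀ β → Separates β (T (k + i)) → β (rep G (V i)) ≡ β (rep G (U i)) xor join
      joined′ β sep = flip-sides (β (rep G (U i))) (β (rep G (V i))) join (joined β sep)
        where
        flip-sides : ∀ p q f → p ≡ q xor f → q ≡ p xor f
        flip-sides p false false refl = refl
        flip-sides p false true  refl = refl
        flip-sides p true  false refl = refl
        flip-sides p true  true  refl = refl

    module _ {a b : ℕ} (a-root : parent a ≡ 0) (b-root : parent b ≡ 0) (a≢b : a ≢ b)
             (a<n : a < n) (b<n : b < n) (a≤b : size a ≤ size b) where

      open Link forest a-root b-root a≢b join

      -- Sizes decide which root is absorbed, so the argument leaves open whether `a` is the root of
      -- `U i` or of `V i`; the two premises account for the difference.
      link-edge : (∀ β → Separates β (T (k + i)) → β a ≡ β b xor join) → Settled linked i →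
                  Progress m parent′ flip′ size′ T′ linked
      link-edge together = advance (forest-linked a≤b b<n) (≤-reflexive (sum-size′ a<n b<n)) forced′
        (λ { (r , h) → rep-linked _ _ r , λ h′ → h (hue-linked _ _ r h′) })
        where
        forced′ : Forced linked (T (k + i))
        forced′ β sep x with rep G x ≟ a
        ... | yes q rewrite proj₁ (moved q) | proj₁ (proj₂ (moved q)) =
          trans (forced i<k β sep x)
            (trans (cong (_xor hue G x) (trans (cong β q) (together β sep))) (xor-assoc (β b) join _))
        ... | no q rewrite proj₁ (kept q) | proj₁ (proj₂ (kept q)) = forced i<k β sep x

      -- The endpoints now differ in hue, so the second half of `Settled` is vacuous.
      link-U : rep G (U i) ≡ a → rep G (V i) ≡ b → Settled linked i
      link-U refl refl with moved {U i} refl | kept {V i} (a≢b ∘ sym)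
      ... | r , h , _ | r′ , h′ , _ = trans r (sym r′) , λ eq →
        contradiction (trans (sym h) (trans eq h′)) (parity-joined (hue G (U i)) (hue G (V i)))

      link-V : rep G (V i) ≡ a → rep G (U i) ≡ b → Settled linked i
      link-V refl refl with moved {V i} refl | kept {U i} (a≢b ∘ sym)
      ... | r , h , _ | r′ , h′ , _ = trans r′ (sym r) , λ eq →
        contradiction (trans (sym h) (trans (sym eq) h′))
          (subst (λ c → not c xor hue G (V i) ≢ hue G (U i)) (xor-comm (hue G (U i)) (hue G (V i))) (parity-joined (hue G (V i)) (hue G (U i))))

-- Tournament trees: the children of node j are 2j and 2j + 1.

halves : ∀ i → i ≡ ⌊ i /2⌋ + ⌊ i /2⌋ ⊎ i ≡ suc (⌊ i /2⌋ + ⌊ i /2⌋)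
halves zero          = inj₁ refl
halves (suc zero)    = inj₂ refl
halves (suc (suc i)) with halves i
... | inj₁ eq = inj₁ (cong suc (trans (cong suc eq) (sym (+-suc _ _))))
... | inj₂ eq = inj₂ (cong suc (trans (cong suc eq) (cong suc (sym (+-suc _ _)))))

half-even : ∀ j → ⌊ j + j /2⌋ ≡ j
half-even j = sym (n≡⌊n+n/2⌋ j)

half-odd : ∀ j → ⌊ suc (j + j) /2⌋ ≡ j
half-odd j = sym (n≡⌈n+n/2⌉ j)

half-< : ∀ {i k} → i < k + k → ⌊ i /2⌋ < k
half-< {i} {k} i<2k = ≰⇒> λ k≤h → <⇒≱ i<2k (≤-trans (+-mono-≤ k≤h k≤h) (bound (halves i)))
  where
  bound : i ≡ ⌊ i /2⌋ + ⌊ i /2⌋ ⊎ i ≡ suc (⌊ i /2⌋ + ⌊ i /2⌋) → ⌊ i /2⌋ + ⌊ i /2⌋ ≤ i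
  bound (inj₁ eq) = ≤-reflexive (sym eq)
  bound (inj₂ eq) = ≤-trans (n≤1+n _) (≤-reflexive (sym eq))

double-< : ∀ {i k} → i < k → suc (i + i) < k + k
double-< {i} {k} i<k = ≤-trans (≤-reflexive (cong suc (sym (+-suc i i)))) (+-mono-≤ i<k i<k)

-- Imposed on the inner nodes 1 to k - 1, with leaves k to 2k - 1. This is a binary tree for every
-- positive k, power of two or not.
Won : (ℕ → ℚ) → ℕ → Set
Won T j = T j ≡ T (j + j) ⊔ T (suc (j + j))

-- Strong induction towards the root: a node is at most its parent, which has a smaller index.
winner-top : ∀ {T k} → (∀ {j} → 0 < j → j < k → Won T j) →
             ∀ j → 0 < j → j < k + k → T j ℚ.≤ T 1
winner-top {T} {k} won = <-rec _ λ j rec 0<j j<2k →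
  go j rec 0<j ⌊ j /2⌋ (half-< j<2k) (halves j)
  where
  child≤ : ∀ h {j} → 0 < h → h < k → j ≡ h + h ⊎ j ≡ suc (h + h) → T j ℚ.≤ T h
  child≤ h 0<h h<k c rewrite won 0<h h<k with c
  ... | inj₁ refl = ℚₚ.p≤p⊔q (T (h + h)) (T (suc (h + h)))
  ... | inj₂ refl = ℚₚ.p≤q⊔p (T (h + h)) (T (suc (h + h)))
  parent< : ∀ h {j} → 0 < h → j ≡ h + h ⊎ j ≡ suc (h + h) → h < j
  parent< h 0<h (inj₁ refl) = m<m+n h 0<h
  parent< h 0<h (inj₂ refl) = s≤s (m≤m+n h h)
  go : ∀ j → (∀ {h} → h < j → 0 < h → h < k + k → T h ℚ.≤ T 1) → 0 < j →
       ∀ h → h < k → j ≡ h + h ⊎ j ≡ suc (h + h) → T j ℚ.≤ T 1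
  go _ rec ()  zero      h<k (inj₁ refl)
  -- Half of j is 0 only for j = 1, the root itself.
  go _ rec 0<j zero      h<k (inj₂ refl) = ℚₚ.≤-refl
  go j rec 0<j h@(suc _) h<k c           = ℚₚ.≤-trans (child≤ h (s≤s z≤n) h<k c)
    (rec (parent< h (s≤s z≤n) c) (s≤s z≤n) (≤-trans h<k (m≤m+n k k)))

module _ (T : ℕ → ℚ) where

  -- Cell i enters only the equations of i and of its parent, which is why replaying one path
  -- repairs the tree.
  won-elsewhere : ∀ {i j} x → Won T j → j ≢ i → j ≢ ⌊ i /2⌋ → Won (update T i x) j
  won-elsewhere {i} {j} x won j≢i j≢h = begin
    update T i x j                                          ≡⟨ update-other T {i} x j≢i ⟩
    T j                                                     ≡⟨ won ⟩
    T (j + j) ⊔ T (suc (j + j))                             ≡⟨ cong₂ _⊔_ (update-other T {i} x λ { refl → j≢h (sym (half-even j)) })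
                                                                         (update-other T {i} x λ { refl → j≢h (sym (half-odd j)) }) ⟨
    update T i x (j + j) ⊔ update T i x (suc (j + j))       ∎
    where open ≡-Reasoning

  -- Positivity matters because 0 would be its own child.
  won-here : ∀ {i} → 0 < i → Won (update T i (T (i + i) ⊔ T (suc (i + i)))) i
  won-here {i} 0<i = trans (update-same T i _)
    (sym (cong₂ _⊔_ (update-other T {i} _ (<⇒≢ (m<m+n i 0<i) ∘ sym))
                    (update-other T {i} _ (<⇒≢ (s≤s (m≤m+n i i)) ∘ sym))))

-- The program

kV nodeV parityV leafV counterV nodeV′ parityV′ innerV : ℕ
kV       = 1
nodeV    = 2
parityV  = 3
leafV    = 4
counterV = 5
nodeV′   = 6
parityV′ = 7
innerV   = 8

listA outA leftA rightA halfA parentA flipA sizeA : ℕ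
listA   = 0
outA    = 1
leftA   = 2
rightA  = 3
halfA   = 4
parentA = 5
flipA   = 6
sizeA   = 7

-- Nothing is ever written to zeroQ.
timesQ treeQ zeroQ : ℕ
timesQ = 0
treeQ  = 1
zeroQ  = 2

leaves-left : Test
leaves-left = var leafV ≺ var kV ⊕ var kV

-- Leaf k + i of the tree is edge i; counterV is the position in the listing,
-- initially 0.
fill-step fill : Program
fill-step =
  leftA [ var leafV ]≔ listA [ lit 1 ⊕ var counterV ] ⨾
  rightA [ var leafV ]≔ listA [ lit 2 ⊕ var counterV ] ⨾
  treeQ ⟦ var leafV ⟧≔ timesQ ⟦ listA [ lit 1 ⊕ var counterV ] ⟧ ⊞ timesQ ⟦ listA [ lit 2 ⊕ var counterV ] ⟧ ⨾
  counterV ≔ lit 3 ⊕ var counterV ⨾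
  leafV ≔ lit 1 ⊕ var leafV
fill =
  leafV ≔ var kV ⨾
  while leaves-left fill-step

replay : ℕ → Program
replay x =
  cond (treeQ ⟦ var x ⊕ var x ⟧ ≼ treeQ ⟦ lit 1 ⊕ (var x ⊕ var x) ⟧)
    (treeQ ⟦ var x ⟧≔ treeQ ⟦ lit 1 ⊕ (var x ⊕ var x) ⟧)
    (treeQ ⟦ var x ⟧≔ treeQ ⟦ var x ⊕ var x ⟧)

-- The machine cannot halve, so the parents in the tree are tabulated during its construction. Cells
-- 0 and 1 stay 0, and this value ends the ascent.
set-halves build-step build : Program
set-halves =
  halfA [ var leafV ⊕ var leafV ]≔ var leafV ⨾
  halfA [ lit 1 ⊕ (var leafV ⊕ var leafV) ]≔ var leafV
build-step =
  set-halves ⨾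
  replay leafV ⨾
  leafV ≔ var leafV ⊖ lit 1
build =
  leafV ≔ var kV ⊖ lit 1 ⨾
  while (neg (var leafV ≐ lit 0)) build-step

descend-step descend : Program
descend-step =
  cond (treeQ ⟦ var leafV ⊕ var leafV ⟧ ≼ treeQ ⟦ lit 1 ⊕ (var leafV ⊕ var leafV) ⟧)
    (leafV ≔ lit 1 ⊕ (var leafV ⊕ var leafV))
    (leafV ≔ var leafV ⊕ var leafV)
descend =
  leafV ≔ lit 1 ⨾
  while (var leafV ≺ var kV) descend-step

erase : Program
erase =
  treeQ ⟦ var leafV ⟧≔ zeroQ ⟦ lit 0 ⟧ ⨾
  innerV ≔ halfA [ var leafV ]

ascend-step ascend : Program
ascend-step =
  replay innerV ⨾
  innerV ≔ halfA [ var innerV ]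
ascend = while (neg (var innerV ≐ lit 0)) ascend-step

distanceE : IExp → IExp → IExp
distanceE d e = (d ⊖ e) ⊕ (e ⊖ d)

-- Union by size alone keeps the paths short; without path compression, searching changes no array.
climb find : Program
climb =
  parityV ≔ distanceE (flipA [ var nodeV ]) (var parityV) ⨾
  nodeV ≔ parentA [ var nodeV ] ⊖ lit 1
find =
  parityV ≔ lit 0 ⨾
  while (neg (parentA [ var nodeV ] ≐ lit 0)) climb

-- The new flip is `join`, computed from the two path parities. It is symmetric in them and so
-- serves both directions.
link : ℕ → ℕ → Program
link a b =
  parentA [ var a ]≔ lit 1 ⊕ var b ⨾
  flipA [ var a ]≔ lit 1 ⊖ distanceE (var parityV) (var parityV′) ⨾
  sizeA [ var b ]≔ lit 1 ⊕ (sizeA [ var b ] ⊕ sizeA [ var a ]) ⨾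
  sizeA [ var a ]≔ lit 0

merge : Program
merge =
  cond (var nodeV ≐ var nodeV′) skip
    (cond (sizeA [ var nodeV ] ≺ sizeA [ var nodeV′ ]) (link nodeV nodeV′) (link nodeV′ nodeV))

go-left save process : Program
go-left = nodeV ≔ leftA [ var leafV ]
save =
  nodeV′ ≔ var nodeV ⨾
  parityV′ ≔ var parityV ⨾
  nodeV ≔ rightA [ var leafV ]
process = go-left ⨾ find ⨾ save ⨾ find ⨾ merge

drain-step drain : Program
drain-step =
  descend ⨾ erase ⨾ ascend ⨾ process ⨾
  counterV ≔ var counterV ⊖ lit 1
drain =
  counterV ≔ var kV ⨾
  while (neg (var counterV ≐ lit 0)) drain-step

-- Painting goes edge by edge, so jobs in no scenario cost nothing and stay on machine 2.
paint-left paint-right paint-step paint : Program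
paint-left =
  outA [ leftA [ var leafV ] ]≔ var parityV ⨾
  nodeV ≔ rightA [ var leafV ]
paint-right =
  outA [ rightA [ var leafV ] ]≔ var parityV ⨾
  leafV ≔ lit 1 ⊕ var leafV
paint-step = go-left ⨾ find ⨾ paint-left ⨾ find ⨾ paint-right
paint =
  leafV ≔ var kV ⨾
  while leaves-left paint-step

kruskal : Program
kruskal = fill ⨾ build ⨾ drain ⨾ paint

loopTime : Test → ℕ → ℕ → ℕ
loopTime b m T = m * (tcost b + T) + tcost b

replayTime : ℕ
replayTime = tcost (treeQ ⟦ var 0 ⊕ var 0 ⟧ ≼ treeQ ⟦ lit 1 ⊕ (var 0 ⊕ var 0) ⟧)
             + (cost (treeQ ⟦ var 0 ⟧≔ treeQ ⟦ lit 1 ⊕ (var 0 ⊕ var 0) ⟧)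
                + cost (treeQ ⟦ var 0 ⟧≔ treeQ ⟦ var 0 ⊕ var 0 ⟧))

linkTime mergeTime descend-stepTime build-stepTime ascend-stepTime : ℕ
linkTime         = cost (link nodeV nodeV′)
mergeTime        = tcost (var nodeV ≐ var nodeV′) + (cost skip +
                   (tcost (sizeA [ var nodeV ] ≺ sizeA [ var nodeV′ ]) + (linkTime + linkTime)))
descend-stepTime = tcost (treeQ ⟦ var leafV ⊕ var leafV ⟧ ≼ treeQ ⟦ lit 1 ⊕ (var leafV ⊕ var leafV) ⟧)
                   + (cost (leafV ≔ lit 1 ⊕ (var leafV ⊕ var leafV)) + cost (leafV ≔ var leafV ⊕ var leafV))
build-stepTime   = cost set-halves + (replayTime + cost (leafV ≔ var leafV ⊖ lit 1))
ascend-stepTime  = replayTime + cost (innerV ≔ halfA [ var innerV ])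

-- Durations that are affine in the bound L on the number of iterations
-- of the innermost loops.
data Time : Set where
  fixed    : ℕ → Time
  _∔_      : Time → Time → Time
  repeated : Test → ℕ → Time

infixr 6 _∔_

duration : Time → ℕ → ℕ
duration (fixed a)      L = a
duration (T ∔ U)        L = duration T L + duration U L
duration (repeated b T) L = loopTime b L T

findTime descendTime ascendTime processTime drain-stepTime paint-stepTime : Time
findTime       = fixed (cost (parityV ≔ lit 0)) ∔ repeated (neg (parentA [ var nodeV ] ≐ lit 0)) (cost climb)
descendTime    = fixed (cost (leafV ≔ lit 1)) ∔ repeated (var leafV ≺ var kV) descend-stepTime
ascendTime     = repeated (neg (var innerV ≐ lit 0)) ascend-stepTime
processTime    = fixed (cost go-left) ∔ findTime ∔ fixed (cost save) ∔ findTime ∔ fixed mergeTime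
drain-stepTime = descendTime ∔ fixed (cost erase) ∔ ascendTime ∔ processTime ∔
                 fixed (cost (counterV ≔ var counterV ⊖ lit 1))
paint-stepTime = fixed (cost go-left) ∔ findTime ∔ fixed (cost paint-left) ∔ findTime ∔ fixed (cost paint-right)

fillTime buildTime : ℕ → ℕ
fillTime k  = cost (leafV ≔ var kV) + loopTime leaves-left k (cost fill-step)
buildTime k = cost (leafV ≔ var kV ⊖ lit 1) + loopTime (neg (var leafV ≐ lit 0)) k build-stepTime

drainTime paintTime kruskalTime : ℕ → ℕ → ℕ
drainTime k L   = cost (counterV ≔ var kV) + loopTime (neg (var counterV ≐ lit 0)) k (duration drain-stepTime L)
paintTime k L   = cost (leafV ≔ var kV) + loopTime leaves-left k (duration paint-stepTime L)
kruskalTime k L = fillTime k + (buildTime k + (drainTime k L + paintTime k L))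

-- Verification

replay-runs : ∀ x {s Q} →
              (let i = vars s x; T = nums s treeQ in
               Q (record s { nums = update₂ (nums s) treeQ i (T (i + i) ⊔ T (suc (i + i))) })) →
              Runs (replay x) s replayTime Q
replay-runs x {s} {Q} q = branch
  (λ eq → block _ (subst after (ℚₚ.p≤q⇒p⊔q≡q (does-true (T (i + i) ℚ.≤? T (suc (i + i))) eq)) q))
  (λ eq → block _ (subst after (ℚₚ.p≥q⇒p⊔q≡p (reverse (does-false (T (i + i) ℚ.≤? T (suc (i + i))) eq))) q))
  where
  i : ℕ
  i = vars s x
  T : ℕ → ℚ
  T = nums s treeQ
  after : ℚ → Set
  after v = Q (record s { nums = update₂ (nums s) treeQ i v })
  reverse : ∀ {p q} → ¬ p ℚ.≤ q → q ℚ.≤ p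
  reverse p≰q = ℚₚ.<⇒≤ (ℚₚ.≰⇒> p≰q)

-- The offset 4 in `frame` skips `nodeV` and `parityV`, the variables that `find` writes.
record Found (G : Ghost) (s s′ : State) : Set where
  constructor found
  field
    arrs≡ : arrs s′ ≡ arrs s
    nums≡ : nums s′ ≡ nums s
    node≡ : vars s′ nodeV ≡ rep G (vars s nodeV)
    parity≡ : vars s′ parityV ≡ bit (hue G (vars s nodeV))
    k≡ : vars s′ kV ≡ vars s kV
    frame : ∀ x → vars s′ (4 + x) ≡ vars s (4 + x)

-- `seen` is the parity of the path climbed so far, and the index is the depth that remains.
record Finding (G : Ghost) (s : State) (m : ℕ) (s′ : State) : Set where
  constructor finding
  field
    arrs≡ : arrs s′ ≡ arrs s
    nums≡ : nums s′ ≡ nums s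
    rep≡ : rep G (vars s′ nodeV) ≡ rep G (vars s nodeV)
    seen : Bool
    parity≡ : vars s′ parityV ≡ bit seen
    hue≡ : hue G (vars s nodeV) ≡ seen xor hue G (vars s′ nodeV)
    depth≡ : depth G (vars s′ nodeV) ≡ m
    k≡ : vars s′ kV ≡ vars s kV
    frame : ∀ x → vars s′ (4 + x) ≡ vars s (4 + x)

find-runs : ∀ {n L s G} → Forest n (arrs s parentA) (arrs s flipA) (arrs s sizeA) G →
            depth G (vars s nodeV) ≤ L → Runs find s (duration findTime L) (Found G s)
find-runs {n} {L} {s} {G} F d≤L =
  weaken (+-monoʳ-≤ (cost (parityV ≔ lit 0))
           (+-monoˡ-≤ (tcost b) (*-monoˡ-≤ (tcost b + cost climb) d≤L)))
    ((parityV ≔ lit 0) ▸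
      map-post done
        (loop {b} {climb} (Finding G s) stop step
          (finding refl refl refl false refl refl refl refl (λ _ → refl))))
  where
  open Forest F
  b : Test
  b = neg (parentA [ var nodeV ] ≐ lit 0)
  at : ∀ {s′} → arrs s′ ≡ arrs s → tval b s′ ≡ false → arrs s parentA (vars s′ nodeV) ≡ 0
  at {s′} refl eq = does-true (arrs s parentA (vars s′ nodeV) ≟ 0) (not-false eq)
  inside : ∀ {s′} → arrs s′ ≡ arrs s → tval b s′ ≡ true → arrs s parentA (vars s′ nodeV) ≢ 0
  inside {s′} refl eq = does-false (arrs s parentA (vars s′ nodeV) ≟ 0) (not-true eq)
  done : ∀ {s′} → tval b s′ ≡ false × ∃[ m ] Finding G s m s′ → Found G s s′
  done {s′} (eq , _ , finding a≡ n≡ r c p h _ k f)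
    with at-root (at {s′} a≡ eq)
  ... | r₀ , h₀ , _ = found a≡ n≡ (trans (sym r₀) r)
    (trans p (cong bit (sym (trans h (trans (cong (c xor_) h₀) (xor-identityʳ c)))))) k f
  stop : ∀ {s′} → Finding G s 0 s′ → tval b s′ ≡ true → ⊥
  stop {s′} (finding a≡ _ _ _ _ _ d _ _) eq with node (vars s′ nodeV)
  ... | root p _ _ _ = inside {s′} a≡ eq p
  ... | child _ _ _ _ d′ with () ← trans (sym d) d′
  step : ∀ {m s′} → Finding G s (suc m) s′ → tval b s′ ≡ true →
         Runs climb s′ (cost climb) (Finding G s m)
  step {m} {state v _ q} (finding refl refl r c p h d k f) eq with node (v nodeV)
  ... | root p₀ _ _ _ = ⊥-elim (inside {state v _ q} refl eq p₀)
  ... | child {y} {e} par fl r′ h′ d′ = block climb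
    (finding refl refl (trans (cong (rep G) up) (trans (sym r′) r)) (e xor c)
      (trans (cong₂ distance fl p) (bit-xor e c))
      (trans h (trans (cong (c xor_) h′) (trans (shuffle c e (hue G y)) (cong (λ z → (e xor c) xor hue G z) (sym up)))))
      (trans (cong (depth G) up) (suc-injective (trans (sym d′) d))) k f)
    where
    up : arrs s parentA (v nodeV) ∸ 1 ≡ y
    up = cong (_∸ 1) par
    shuffle : ∀ x y z → x xor (y xor z) ≡ (y xor x) xor z
    shuffle x y z = trans (xor-swap x y z) (sym (xor-assoc y x z))

-- One L serves all inner loops: `k+k≤2^L` bounds the descent, `k<2^L` the ascent and the depth of
-- the union-find trees. A scenario takes three cells of the listing, its size and two members,
-- whence `i * 3`.
module Kruskal (n k L : ℕ) (list : ℕ → ℕ) (time : ℕ → ℚ)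
               (U<n : ∀ {i} → i < k → list (1 + i * 3) < n)
               (V<n : ∀ {i} → i < k → list (2 + i * 3) < n)
               (time≥0 : ∀ j → 0ℚ ℚ.≤ time j)
               (k+k≤2^L : k + k ≤ 2 ^ L) (k<2^L : k < 2 ^ L) where

  U V : ℕ → ℕ
  U i = list (1 + i * 3)
  V i = list (2 + i * 3)

  weight : ℕ → ℚ
  weight i = time (U i) ℚ.+ time (V i)

  weight≥0 : ∀ {i} → i < k → 0ℚ ℚ.≤ weight i
  weight≥0 {i} _ = ℚₚ.≤-trans (ℚₚ.≤-reflexive (sym (ℚₚ.+-identityʳ 0ℚ))) (ℚₚ.+-mono-≤ (time≥0 (U i)) (time≥0 (V i)))

  open Edges n k U V weight U<n V<n weight≥0

  extend : ∀ {X : Set} (f : ℕ → X) (g : ℕ → X) {i l x} → (∀ {j} → j < i → f (k + j) ≡ g j) →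
           l ≡ k + i → x ≡ g i → ∀ {j} → j < suc i → update f l x (k + j) ≡ g j
  extend f g {i} {x = x} below refl refl {j} j<1+i with m<1+n⇒m<n∨m≡n j<1+i
  ... | inj₁ j<i  = trans (update-other f {k + i} x (<⇒≢ (+-monoʳ-< k j<i))) (below j<i)
  ... | inj₂ refl = update-same f (k + i) x

  -- Filling the leaves

  record Start (s : State) : Set where
    field
      k≡ : vars s kV ≡ k
      counter≡ : vars s counterV ≡ 0
      list≡ : arrs s listA ≡ list
      time≡ : nums s timesQ ≡ time
      half≡ : arrs s halfA ≡ λ _ → 0
      parent≡ : arrs s parentA ≡ λ _ → 0
      flip≡ : arrs s flipA ≡ λ _ → 0
      size≡ : arrs s sizeA ≡ λ _ → 0
      zero≡ : nums s zeroQ ≡ λ _ → 0ℚ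

  record Filling (m : ℕ) (s : State) : Set where
    field
      {i} : ℕ
      k≡ : vars s kV ≡ k
      leaf≡ : vars s leafV ≡ k + i
      counter≡ : vars s counterV ≡ i * 3
      total : i + m ≡ k
      list≡ : arrs s listA ≡ list
      time≡ : nums s timesQ ≡ time
      lefts : ∀ {j} → j < i → arrs s leftA (k + j) ≡ U j
      rights : ∀ {j} → j < i → arrs s rightA (k + j) ≡ V j
      leaves : ∀ {j} → j < i → nums s treeQ (k + j) ≡ weight j
      half≡ : arrs s halfA ≡ λ _ → 0
      parent≡ : arrs s parentA ≡ λ _ → 0
      flip≡ : arrs s flipA ≡ λ _ → 0
      size≡ : arrs s sizeA ≡ λ _ → 0
      zero≡ : nums s zeroQ ≡ λ _ → 0ℚ

  record Loaded (s : State) : Set where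
    field
      k≡ : vars s kV ≡ k
      lefts : ∀ {j} → j < k → arrs s leftA (k + j) ≡ U j
      rights : ∀ {j} → j < k → arrs s rightA (k + j) ≡ V j
      zero≡ : nums s zeroQ ≡ λ _ → 0ℚ

  record Filled (s : State) : Set where
    field
      loaded : Loaded s
      leaves : ∀ {j} → j < k → nums s treeQ (k + j) ≡ weight j
      half≡ : arrs s halfA ≡ λ _ → 0
      parent≡ : arrs s parentA ≡ λ _ → 0
      flip≡ : arrs s flipA ≡ λ _ → 0
      size≡ : arrs s sizeA ≡ λ _ → 0

  more-leaves : ∀ {s i} → vars s kV ≡ k → vars s leafV ≡ k + i → tval leaves-left s ≡ true → i < k
  more-leaves {s} {i} refl leaf≡ eq = +-cancelˡ-< k i k
    (subst (_< k + k) leaf≡ (does-true (vars s leafV <? k + k) eq))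

  no-more-leaves : ∀ {s i m} → vars s kV ≡ k → vars s leafV ≡ k + i → i + m ≡ k →
                   tval leaves-left s ≡ false → i ≡ k
  no-more-leaves {s} {i} {m} refl leaf≡ total eq = ≤-antisym (≤-trans (m≤m+n i m) (≤-reflexive total))
    (+-cancelˡ-≤ k k i (subst (k + k ≤_) leaf≡ (≮⇒≥ (does-false (vars s leafV <? k + k) eq))))

  fill-runs : ∀ {s} → Start s → Runs fill s (fillTime k) Filled
  fill-runs {s} st = (leafV ≔ var kV) ▸ map-post finish (loop Filling stop step start)
    where
    open Start st
    start : Filling k (exec (leafV ≔ var kV) s)
    start = record
      { i = 0 ; k≡ = k≡ ; leaf≡ = trans k≡ (sym (+-identityʳ k)) ; counter≡ = counter≡ ; total = refl
      ; list≡ = list≡ ; time≡ = time≡ ; lefts = λ () ; rights = λ () ; leaves = λ ()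
      ; half≡ = half≡ ; parent≡ = parent≡ ; flip≡ = flip≡ ; size≡ = size≡ ; zero≡ = zero≡ }
    stop : ∀ {s} → Filling 0 s → tval leaves-left s ≡ true → ⊥
    stop {s} f eq = <-irrefl (trans (sym (+-identityʳ _)) F.total) (more-leaves {s} F.k≡ F.leaf≡ eq)
      where module F = Filling f
    step : ∀ {m s} → Filling (suc m) s → tval leaves-left s ≡ true → Runs fill-step s (cost fill-step) (Filling m)
    step {m} {s} f eq = block fill-step record
      { i = suc F.i ; k≡ = F.k≡
      ; leaf≡ = trans (cong suc F.leaf≡) (sym (+-suc k F.i))
      ; counter≡ = cong (3 +_) F.counter≡
      ; total = trans (sym (+-suc F.i m)) F.total
      ; list≡ = F.list≡ ; time≡ = F.time≡
      ; lefts = extend (arrs s leftA) U F.lefts F.leaf≡ at-U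
      ; rights = extend (arrs s rightA) V F.rights F.leaf≡ at-V
      ; leaves = extend (nums s treeQ) weight F.leaves F.leaf≡ (cong₂ ℚ._+_ (cong₂ (λ f x → f x) F.time≡ at-U) (cong₂ (λ f x → f x) F.time≡ at-V))
      ; half≡ = F.half≡ ; parent≡ = F.parent≡ ; flip≡ = F.flip≡ ; size≡ = F.size≡ ; zero≡ = F.zero≡ }
      where
      module F = Filling f
      at-U : arrs s listA (1 + vars s counterV) ≡ U F.i
      at-U = cong₂ (λ f c → f (1 + c)) F.list≡ F.counter≡
      at-V : arrs s listA (2 + vars s counterV) ≡ V F.i
      at-V = cong₂ (λ f c → f (2 + c)) F.list≡ F.counter≡
    finish : ∀ {s′} → tval leaves-left s′ ≡ false × ∃[ m ] Filling m s′ → Filled s′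
    finish {s′} (eq , _ , f) = record
      { loaded = record { k≡ = F.k≡ ; lefts = F.lefts ∘ upto ; rights = F.rights ∘ upto ; zero≡ = F.zero≡ }
      ; leaves = F.leaves ∘ upto
      ; half≡ = F.half≡ ; parent≡ = F.parent≡ ; flip≡ = F.flip≡ ; size≡ = F.size≡ }
      where
      module F = Filling f
      upto : ∀ {j} → j < k → j < F.i
      upto = subst (_ <_) (sym (no-more-leaves {s′} F.k≡ F.leaf≡ F.total eq))

  -- Building the tournament tree

  record Built (s : State) : Set where
    field
      loaded : Loaded s
      halved : ∀ {i} → i < k + k → arrs s halfA i ≡ ⌊ i /2⌋
      leaves : ∀ {j} → j < k → nums s treeQ (k + j) ≡ weight j
      won : ∀ {j} → 0 < j → j < k → Won (nums s treeQ) j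
      parent≡ : arrs s parentA ≡ λ _ → 0
      flip≡ : arrs s flipA ≡ λ _ → 0
      size≡ : arrs s sizeA ≡ λ _ → 0

  -- The nodes above `m` are finished; going downwards, both children of a node are ready before it.
  record Building (m : ℕ) (s : State) : Set where
    field
      loaded : Loaded s
      leaf≡ : vars s leafV ≡ m
      m≤ : m ≤ k ∸ 1
      unset : ∀ {i} → ⌊ i /2⌋ ≡ 0 → arrs s halfA i ≡ 0
      halved : ∀ {i} → m < ⌊ i /2⌋ → ⌊ i /2⌋ < k → arrs s halfA i ≡ ⌊ i /2⌋
      leaves : ∀ {j} → j < k → nums s treeQ (k + j) ≡ weight j
      won : ∀ {j} → m < j → j < k → Won (nums s treeQ) j
      parent≡ : arrs s parentA ≡ λ _ → 0
      flip≡ : arrs s flipA ≡ λ _ → 0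
      size≡ : arrs s sizeA ≡ λ _ → 0

  set-half : (ℕ → ℕ) → ℕ → ℕ → ℕ
  set-half h j = update (update h (j + j) j) (suc (j + j)) j

  set-half-here : ∀ h i → set-half h ⌊ i /2⌋ i ≡ ⌊ i /2⌋
  set-half-here h i with halves i
  ... | inj₂ eq = trans (cong (set-half h ⌊ i /2⌋) eq) (update-same (update h (⌊ i /2⌋ + ⌊ i /2⌋) ⌊ i /2⌋) (suc (⌊ i /2⌋ + ⌊ i /2⌋)) ⌊ i /2⌋)
  ... | inj₁ eq = trans (cong (set-half h ⌊ i /2⌋) eq)
    (trans (update-other (update h (⌊ i /2⌋ + ⌊ i /2⌋) ⌊ i /2⌋) {suc (⌊ i /2⌋ + ⌊ i /2⌋)} ⌊ i /2⌋ (<⇒≢ (n<1+n _)))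
           (update-same h (⌊ i /2⌋ + ⌊ i /2⌋) ⌊ i /2⌋))

  set-half-other : ∀ h {i j} → ⌊ i /2⌋ ≢ j → set-half h j i ≡ h i
  set-half-other h {i} {j} neq =
    trans (update-other (update h (j + j) j) {suc (j + j)} {i} j (λ { refl → neq (half-odd j) }))
          (update-other h {j + j} {i} j (λ { refl → neq (half-even j) }))

  leaf-untouched : ∀ (T : ℕ → ℚ) {i} x j → i < k → update T i x (k + j) ≡ T (k + j)
  leaf-untouched T {i} x j i<k = update-other T {i} x (<⇒≢ (<-≤-trans i<k (m≤m+n k j)) ∘ sym)

  build-runs : ∀ {s} → Filled s → Runs build s (buildTime k) Built
  build-runs {s} st = weaken
    (+-monoʳ-≤ (cost (leafV ≔ var kV ⊖ lit 1)) (+-monoˡ-≤ (tcost b) (*-monoˡ-≤ (tcost b + build-stepTime) (m∸n≤m k 1))))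
    ((leafV ≔ var kV ⊖ lit 1) ▸ map-post finish (loop Building stop step start))
    where
    b : Test
    b = neg (var leafV ≐ lit 0)
    -- Subtraction is truncated: the positivity of i given by `j < i` is needed to exclude k = 0.
    below : ∀ {j i} → j < i → i ≤ k ∸ 1 → i < k
    below {j} {i} j<i i≤ = go k i≤
      where
      go : ∀ k → i ≤ k ∸ 1 → i < k
      go zero    i≤0 = ⊥-elim (<⇒≱ j<i (≤-trans i≤0 z≤n))
      go (suc _) i≤k = s≤s i≤k
    past : ∀ {j} → k ∸ 1 < j → j < k → ⊥
    past {j} = go k
      where
      go : ∀ k → k ∸ 1 < j → j < k → ⊥
      go (suc k) k<j j<1+k = <⇒≱ k<j (s≤s⁻¹ j<1+k)
    start : Building (k ∸ 1) (exec (leafV ≔ var kV ⊖ lit 1) s)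
    start = record
      { loaded = record { k≡ = Ld.k≡ ; lefts = Ld.lefts ; rights = Ld.rights ; zero≡ = Ld.zero≡ }
      ; leaf≡ = cong (_∸ 1) Ld.k≡ ; m≤ = ≤-refl
      ; unset = λ {i} _ → cong (λ f → f i) F.half≡
      ; halved = λ m<h h<k → ⊥-elim (past m<h h<k)
      ; leaves = F.leaves
      ; won = λ m<j j<k → ⊥-elim (past m<j j<k)
      ; parent≡ = F.parent≡ ; flip≡ = F.flip≡ ; size≡ = F.size≡ }
      where
      module F = Filled st
      module Ld = Loaded F.loaded
    stop : ∀ {s} → Building 0 s → tval b s ≡ true → ⊥
    stop {s} f eq = does-false (vars s leafV ≟ 0) (not-true eq) (Building.leaf≡ f)
    step : ∀ {m s} → Building (suc m) s → tval b s ≡ true → Runs build-step s build-stepTime (Building m)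
    step {m} {s} f eq = set-halves ▸ seq (replay-runs leafV (block (leafV ≔ var leafV ⊖ lit 1) record
      { loaded = record { k≡ = Ld.k≡ ; lefts = Ld.lefts ; rights = Ld.rights ; zero≡ = Ld.zero≡ }
      ; leaf≡ = cong (_∸ 1) B.leaf≡
      ; m≤ = ≤-trans (n≤1+n m) B.m≤
      ; unset = λ {i} i₀ → trans (set-half-other H {i} {j} (λ e → <⇒≢ 0<j (trans (sym i₀) e))) (B.unset i₀)
      ; halved = half′
      ; leaves = λ {i} i<k → trans (leaf-untouched T {j} w i j<k) (B.leaves i<k)
      ; won = won′
      ; parent≡ = B.parent≡ ; flip≡ = B.flip≡ ; size≡ = B.size≡ }))
      where
      module B = Building f
      module Ld = Loaded B.loaded
      T : ℕ → ℚ
      T = nums s treeQ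
      H : ℕ → ℕ
      H = arrs s halfA
      j : ℕ
      j = vars s leafV
      w : ℚ
      w = T (j + j) ⊔ T (suc (j + j))
      0<j : 0 < j
      0<j = subst (0 <_) (sym B.leaf≡) (s≤s z≤n)
      j<k : j < k
      j<k = subst (_< k) (sym B.leaf≡) (below (n<1+n m) B.m≤)
      half′ : ∀ {i} → m < ⌊ i /2⌋ → ⌊ i /2⌋ < k → set-half H j i ≡ ⌊ i /2⌋
      half′ {i} m<h h<k with ⌊ i /2⌋ ≟ j
      ... | yes e = trans (cong (λ z → set-half H z i) (sym e)) (set-half-here H i)
      ... | no e  = trans (set-half-other H {i} {j} e)
        (B.halved (≤∧≢⇒< m<h (λ e′ → e (trans (sym e′) (sym B.leaf≡)))) h<k)
      won′ : ∀ {i} → m < i → i < k → Won (update T j w) i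
      won′ {i} m<i i<k with i ≟ j
      ... | yes refl = won-here T {i} 0<j
      ... | no e     = won-elsewhere T {j} {i} w (B.won (≤∧≢⇒< m<i λ e′ → e (trans (sym e′) (sym B.leaf≡))) i<k) e
        -- The parent of j is at most `m`, outside the range of the invariant, so overwriting j
        -- spoils no equation there.
        (λ e′ → <⇒≱ m<i (≤-trans (≤-reflexive e′) (s≤s⁻¹ (subst (⌊ j /2⌋ <_) B.leaf≡ (half<self j 0<j)))))
        where
        half<self : ∀ n → 0 < n → ⌊ n /2⌋ < n
        half<self (suc n) _ = ⌊n/2⌋<n n
    finish : ∀ {s′} → tval b s′ ≡ false × ∃[ m ] Building m s′ → Built s′
    finish {s′} (eq , m , f) = record
      { loaded = B.loaded
      ; halved = half′
      ; leaves = B.leaves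
      ; won = λ 0<j j<k → B.won (subst (_< _) (sym m≡0) 0<j) j<k
      ; parent≡ = B.parent≡ ; flip≡ = B.flip≡ ; size≡ = B.size≡ }
      where
      module B = Building f
      m≡0 : m ≡ 0
      m≡0 = trans (sym B.leaf≡) (does-true (vars s′ leafV ≟ 0) (not-false eq))
      half′ : ∀ {i} → i < k + k → arrs s′ halfA i ≡ ⌊ i /2⌋
      half′ {i} i<2k with ⌊ i /2⌋ in h
      ... | zero  = B.unset h
      ... | suc _ = trans (B.halved (subst₂ _<_ (sym m≡0) (sym h) (s≤s z≤n)) (half-< i<2k)) h

  -- Extracting the heaviest edge

  record Descended (s s′ : State) : Set where
    constructor descended
    field
      arrs≡ : arrs s′ ≡ arrs s
      nums≡ : nums s′ ≡ nums s
      k≡ : vars s′ kV ≡ vars s kV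
      counter≡ : vars s′ counterV ≡ vars s counterV
      i : ℕ
      i<k : i < k
      leaf≡ : vars s′ leafV ≡ k + i
      top≡ : nums s treeQ (k + i) ≡ nums s treeQ 1

  -- Moving to the larger child keeps the value of the root and at least doubles the index; `reach`
  -- says that the doublings left suffice to pass all inner nodes.
  record Descending (s : State) (m : ℕ) (s′ : State) : Set where
    constructor descending
    field
      arrs≡ : arrs s′ ≡ arrs s
      nums≡ : nums s′ ≡ nums s
      k≡ : vars s′ kV ≡ vars s kV
      counter≡ : vars s′ counterV ≡ vars s counterV
      0<leaf : 0 < vars s′ leafV
      leaf< : vars s′ leafV < k + k
      top≡ : nums s treeQ (vars s′ leafV) ≡ nums s treeQ 1
      reach : k + k ≤ vars s′ leafV * 2 ^ m

  descend-runs : ∀ {s} → vars s kV ≡ k → 0 < k → (∀ {j} → 0 < j → j < k → Won (nums s treeQ) j) →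
                 Runs descend s (duration descendTime L) (Descended s)
  descend-runs {s} k≡ 0<k won = (leafV ≔ lit 1) ▸ map-post finish (loop (Descending s) stop step {m = L}
    (descending refl refl refl refl (s≤s z≤n) (+-mono-≤ 0<k 0<k) refl
      (≤-trans k+k≤2^L (≤-reflexive (sym (+-identityʳ _))))))
    where
    b : Test
    b = var leafV ≺ var kV
    T : ℕ → ℚ
    T = nums s treeQ
    inner< : ∀ {m s′} → Descending s m s′ → tval b s′ ≡ true → vars s′ leafV < k
    inner< {_} {s′} d eq = subst (vars s′ leafV <_) (trans (Descending.k≡ d) k≡)
      (does-true (vars s′ leafV <? vars s′ kV) eq)
    stop : ∀ {s′} → Descending s 0 s′ → tval b s′ ≡ true → ⊥
    stop {s′} d eq = <⇒≱ (inner< d eq) (≤-trans (m≤m+n k k) (≤-trans (Descending.reach d) (≤-reflexive (*-identityʳ _))))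
    double : ∀ i m → i * 2 ^ suc m ≡ (i + i) * 2 ^ m
    double i m = begin
      i * (2 * 2 ^ m)   ≡⟨ *-assoc i 2 (2 ^ m) ⟨
      i * 2 * 2 ^ m     ≡⟨ cong (_* 2 ^ m) (trans (*-comm i 2) (cong (i +_) (+-identityʳ i))) ⟩
      (i + i) * 2 ^ m   ∎
      where open ≡-Reasoning
    step : ∀ {m s′} → Descending s (suc m) s′ → tval b s′ ≡ true →
           Runs descend-step s′ descend-stepTime (Descending s m)
    step {m} {state v _ q} d@(descending refl refl _ _ _ _ _ _) eq = branch
      (λ e → block (leafV ≔ lit 1 ⊕ (var leafV ⊕ var leafV)) (descending refl refl D.k≡ D.counter≡
        (s≤s z≤n) (double-< i<k)
        (trans (sym (trans won-i (ℚₚ.p≤q⇒p⊔q≡q (does-true (T (i + i) ℚ.≤? T (suc (i + i))) e)))) D.top≡)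
        (≤-trans D.reach (≤-trans (≤-reflexive (double i m)) (m≤n+m _ (2 ^ m))))))
      (λ e → block (leafV ≔ var leafV ⊕ var leafV) (descending refl refl D.k≡ D.counter≡
        (≤-trans D.0<leaf (m≤m+n i i)) (≤-trans (n≤1+n _) (double-< i<k))
        (trans (sym (trans won-i (ℚₚ.p≥q⇒p⊔q≡p (ℚₚ.<⇒≤ (ℚₚ.≰⇒> (does-false (T (i + i) ℚ.≤? T (suc (i + i))) e)))))) D.top≡)
        (≤-trans D.reach (≤-reflexive (double i m)))))
      where
      module D = Descending d
      i : ℕ
      i = v leafV
      i<k : i < k
      i<k = inner< d eq
      won-i : Won T i
      won-i = won D.0<leaf i<k
    finish : ∀ {s′} → tval b s′ ≡ false × ∃[ m ] Descending s m s′ → Descended s s′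
    finish {s′} (eq , _ , d) =
      (descended D.arrs≡ D.nums≡ D.k≡ D.counter≡ i
        (+-cancelˡ-< k i k (subst (_< k + k) leaf≡ D.leaf<))
        leaf≡ (trans (cong T (sym leaf≡)) D.top≡))
      where
      module D = Descending d
      k≤leaf : k ≤ vars s′ leafV
      k≤leaf = subst (_≤ vars s′ leafV) (trans D.k≡ k≡) (≮⇒≥ (does-false (vars s′ leafV <? vars s′ kV) eq))
      i : ℕ
      i = vars s′ leafV ∸ k
      leaf≡ : vars s′ leafV ≡ k + i
      leaf≡ = sym (m+[n∸m]≡n k≤leaf)

  -- The equation of the current node alone may fail, so none fails once the index is 0. The bound
  -- in `reach` halves with every step.
  record Ascending (s : State) (m : ℕ) (s′ : State) : Set where
    constructor ascending
    field
      arrs≡ : arrs s′ ≡ arrs s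
      k≡ : vars s′ kV ≡ vars s kV
      counter≡ : vars s′ counterV ≡ vars s counterV
      leaf≡ : vars s′ leafV ≡ vars s leafV
      zero≡ : nums s′ zeroQ ≡ nums s zeroQ
      leaves : ∀ j → nums s′ treeQ (k + j) ≡ nums s treeQ (k + j)
      inner< : vars s′ innerV < k
      reach : vars s′ innerV < 2 ^ m
      won : ∀ {j} → 0 < j → j < k → j ≢ vars s′ innerV → Won (nums s′ treeQ) j

  record Ascended (s s′ : State) : Set where
    constructor ascended
    field
      arrs≡ : arrs s′ ≡ arrs s
      k≡ : vars s′ kV ≡ vars s kV
      counter≡ : vars s′ counterV ≡ vars s counterV
      leaf≡ : vars s′ leafV ≡ vars s leafV
      zero≡ : nums s′ zeroQ ≡ nums s zeroQ
      leaves : ∀ j → nums s′ treeQ (k + j) ≡ nums s treeQ (k + j)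
      won : ∀ {j} → 0 < j → j < k → Won (nums s′ treeQ) j

  ascend-runs : ∀ {s} → (∀ {i} → i < k + k → arrs s halfA i ≡ ⌊ i /2⌋) → vars s innerV < k →
                (∀ {j} → 0 < j → j < k → j ≢ vars s innerV → Won (nums s treeQ) j) →
                Runs ascend s (duration ascendTime L) (Ascended s)
  ascend-runs {s} half inner<k won = map-post finish (loop (Ascending s) stop step {m = L}
    (ascending refl refl refl refl refl (λ _ → refl) inner<k (<-trans inner<k k<2^L) won))
    where
    b : Test
    b = neg (var innerV ≐ lit 0)
    stop : ∀ {s′} → Ascending s 0 s′ → tval b s′ ≡ true → ⊥
    stop {s′} a eq = does-false (vars s′ innerV ≟ 0) (not-true eq) (n<1⇒n≡0 (Ascending.reach a))
    step : ∀ {m s′} → Ascending s (suc m) s′ → tval b s′ ≡ true →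
           Runs ascend-step s′ ascend-stepTime (Ascending s m)
    step {m} {s′} a eq = seq (replay-runs innerV (block (innerV ≔ halfA [ var innerV ])
      (ascending A.arrs≡ A.k≡ A.counter≡ A.leaf≡ A.zero≡
        (λ j → trans (leaf-untouched T {i} w j A.inner<) (A.leaves j))
        (subst (_< k) (sym half-i) (half-< i<2k))
        (subst (_< 2 ^ m) (sym half-i) (half-< (subst (i <_) (cong (2 ^ m +_) (+-identityʳ (2 ^ m))) A.reach)))
        won′)))
      where
      module A = Ascending a
      T : ℕ → ℚ
      T = nums s′ treeQ
      i : ℕ
      i = vars s′ innerV
      w : ℚ
      w = T (i + i) ⊔ T (suc (i + i))
      0<i : 0 < i
      0<i = n≢0⇒n>0 (does-false (i ≟ 0) (not-true eq))
      i<2k : i < k + k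
      i<2k = <-≤-trans A.inner< (m≤m+n k k)
      half-i : arrs s′ halfA i ≡ ⌊ i /2⌋
      half-i = trans (cong (λ f → f halfA i) A.arrs≡) (half i<2k)
      won′ : ∀ {j} → 0 < j → j < k → j ≢ arrs s′ halfA i → Won (update T i w) j
      won′ {j} 0<j j<k neq with j ≟ i
      ... | yes e = subst (Won (update T i w)) (sym e) (won-here T {i} 0<i)
      ... | no e  = won-elsewhere T {i} {j} w (A.won 0<j j<k e) e (λ e′ → neq (trans e′ (sym half-i)))
    finish : ∀ {s′} → tval b s′ ≡ false × ∃[ m ] Ascending s m s′ → Ascended s s′
    finish {s′} (eq , _ , a) =
      (ascended A.arrs≡ A.k≡ A.counter≡ A.leaf≡ A.zero≡ A.leaves
        (λ 0<j j<k → A.won 0<j j<k (λ e′ → <⇒≢ 0<j (sym (trans e′ (does-true (vars s′ innerV ≟ 0) (not-false eq)))))))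
      where module A = Ascending a

  -- Each round links at most once, so a tree has at most k links, and its depth is logarithmic in k
  -- whatever the number of jobs.
  depth-bound : ∀ {m parent flip size T G} → Progress m parent flip size T G → ∀ {x} → x < n → depth G x ≤ L
  depth-bound {size = size} {G = G} P {x} x<n = ≮⇒≥ λ L<d → <⇒≱ (^-monoʳ-< 2 ≤-refl L<d) (begin
    2 ^ depth G x               ≤⟨ balanced x ⟩
    suc (size (rep G x))        ≤⟨ s≤s (term≤sumTo n (rep< x<n)) ⟩
    suc (sumTo n size)          ≤⟨ s≤s (≤-trans (m≤m+n _ _) (Progress.budget P)) ⟩
    suc k                       ≤⟨ k<2^L ⟩
    2 ^ L                       ∎)
    where
    open Forest (Progress.forest P)
    open ≤-Reasoning

  -- Inserting an edge into the forest

  record Processed (m : ℕ) (s s′ : State) : Set where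
    field
      nums≡ : nums s′ ≡ nums s
      k≡ : vars s′ kV ≡ vars s kV
      counter≡ : vars s′ counterV ≡ vars s counterV
      left≡ : arrs s′ leftA ≡ arrs s leftA
      right≡ : arrs s′ rightA ≡ arrs s rightA
      half≡ : arrs s′ halfA ≡ arrs s halfA
      {ghost} : Ghost
      progress : Progress m (arrs s′ parentA) (arrs s′ flipA) (arrs s′ sizeA) (nums s treeQ) ghost

  module _ {m : ℕ} {s : State} {T : ℕ → ℚ} {G : Ghost}
           (P : Progress (suc m) (arrs s parentA) (arrs s flipA) (arrs s sizeA) T G)
           {i : ℕ} (i<k : i < k) (top : ∀ {j} → j < k → T (k + j) ℚ.≤ T (k + i))
           (erased : nums s treeQ (k + i) ≡ 0ℚ)
           (others : ∀ {j} → j < k → j ≢ i → nums s treeQ (k + j) ≡ T (k + j)) where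

    open Forest (Progress.forest P)
    open Step {T′ = nums s treeQ} P i<k top erased others

    merge-runs : vars s nodeV ≡ rep G (V i) → vars s parityV ≡ bit (hue G (V i)) →
                 vars s nodeV′ ≡ rep G (U i) → vars s parityV′ ≡ bit (hue G (U i)) →
                 Runs merge s mergeTime (Processed m s)
    merge-runs nV pV nU pU = branch
      (λ eq → block skip record
        { nums≡ = refl ; k≡ = refl ; counter≡ = refl ; left≡ = refl ; right≡ = refl ; half≡ = refl
        ; progress = skip-edge
            (trans (sym nU) (trans (sym (does-true (vars s nodeV ≟ vars s nodeV′) eq)) nV)) })
      (λ eq → apart (λ e → does-false (vars s nodeV ≟ vars s nodeV′) eq (trans nV (trans (sym e) (sym nU)))))
      where
      join-bit : 1 ∸ distance (vars s parityV) (vars s parityV′) ≡ bit (join)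
      join-bit = trans (cong (1 ∸_) (trans (cong₂ distance pV pU) (bit-xor (hue G (V i)) (hue G (U i)))))
                       (bit-not (hue G (V i) xor hue G (U i)))
      is-root : ∀ {a x} → a ≡ rep G x → arrs s parentA a ≡ 0
      is-root {x = x} refl = rep-root x
      a<n : ∀ {a x} → x < n → a ≡ rep G x → a < n
      a<n x<n refl = rep< x<n
      flipped : ∀ a {size′ G′ parent′} →
        Progress m parent′ (update (arrs s flipA) a (bit (join))) size′ (nums s treeQ) G′ →
        Progress m parent′ (update (arrs s flipA) a (1 ∸ distance (vars s parityV) (vars s parityV′))) size′ (nums s treeQ) G′
      flipped a {size′} {G′} {parent′} =
        subst (λ f → Progress m parent′ (update (arrs s flipA) a f) size′ (nums s treeQ) G′) (sym join-bit)
      apart : rep G (U i) ≢ rep G (V i) →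
              Runs (cond (sizeA [ var nodeV ] ≺ sizeA [ var nodeV′ ]) (link nodeV nodeV′) (link nodeV′ nodeV)) s
                   (tcost (sizeA [ var nodeV ] ≺ sizeA [ var nodeV′ ]) + (linkTime + linkTime)) (Processed m s)
      apart distinct = branch
        (λ eq → let a≢b  = λ e → distinct (trans (sym nU) (trans (sym e) nV))
                    size≤ = <⇒≤ (does-true (arrs s sizeA (vars s nodeV) <? arrs s sizeA (vars s nodeV′)) eq) in
          block (link nodeV nodeV′) record
          { nums≡ = refl ; k≡ = refl ; counter≡ = refl ; left≡ = refl ; right≡ = refl ; half≡ = refl
          ; progress = flipped (vars s nodeV)
              (link-edge (is-root nV) (is-root nU) a≢b (a<n (V<n i<k) nV) (a<n (U<n i<k) nU) size≤
                (λ β sep → subst₂ (λ a b → β a ≡ β b xor join) (sym nV) (sym nU) (joined′ distinct β sep))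
                (link-V (is-root nV) (is-root nU) a≢b (a<n (V<n i<k) nV) (a<n (U<n i<k) nU) size≤ (sym nV) (sym nU))) })
        (λ eq → let a≢b  = λ e → distinct (trans (sym nU) (trans e nV))
                    size≤ = ≮⇒≥ (does-false (arrs s sizeA (vars s nodeV) <? arrs s sizeA (vars s nodeV′)) eq) in
          block (link nodeV′ nodeV) record
          { nums≡ = refl ; k≡ = refl ; counter≡ = refl ; left≡ = refl ; right≡ = refl ; half≡ = refl
          ; progress = flipped (vars s nodeV′)
              (link-edge (is-root nU) (is-root nV) a≢b (a<n (U<n i<k) nU) (a<n (V<n i<k) nV) size≤
                (λ β sep → subst₂ (λ a b → β a ≡ β b xor join) (sym nU) (sym nV) (joined distinct β sep))
                (link-U (is-root nU) (is-root nV) a≢b (a<n (U<n i<k) nU) (a<n (V<n i<k) nV) size≤ (sym nU) (sym nV))) })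

  process-runs : ∀ {m s T G i} →
                 Progress (suc m) (arrs s parentA) (arrs s flipA) (arrs s sizeA) T G →
                 i < k → (∀ {j} → j < k → T (k + j) ℚ.≤ T (k + i)) → nums s treeQ (k + i) ≡ 0ℚ →
                 (∀ {j} → j < k → j ≢ i → nums s treeQ (k + j) ≡ T (k + j)) →
                 vars s leafV ≡ k + i → arrs s leftA (k + i) ≡ U i → arrs s rightA (k + i) ≡ V i →
                 Runs process s (duration processTime L) (Processed m s)
  process-runs {m} {s} {T} {G} {i} P i<k top erased others leaf≡ left≡ right≡ =
    go-left ▸ (find-runs {L = L} forest (bound (U<n i<k) at-U) then λ
      { (state v₁ _ _) (found refl refl n₁ p₁ k₁ f₁) →
        let at-V = trans (cong (arrs s rightA) (trans (f₁ 0) leaf≡)) right≡ in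
        save ▸ (find-runs {L = L} forest (bound (V<n i<k) at-V) then λ
      { (state v₂ _ _) (found refl refl n₂ p₂ k₂ f₂) →
        map-post (λ r → record
          { nums≡ = Processed.nums≡ r ; k≡ = trans (Processed.k≡ r) (trans k₂ k₁)
          ; counter≡ = trans (Processed.counter≡ r) (trans (f₂ 1) (f₁ 1))
          ; left≡ = Processed.left≡ r ; right≡ = Processed.right≡ r ; half≡ = Processed.half≡ r
          ; progress = Processed.progress r })
        (merge-runs {s = state v₂ (arrs s) (nums s)} P i<k top erased others
          (trans n₂ (cong (rep G) at-V)) (trans p₂ (cong (bit ∘ hue G) at-V))
          (trans (f₂ 2) (trans n₁ (cong (rep G) at-U)))
          (trans (f₂ 3) (trans p₁ (cong (bit ∘ hue G) at-U)))) }) })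
    where
    forest : Forest n (arrs s parentA) (arrs s flipA) (arrs s sizeA) G
    forest = Progress.forest P
    bound : ∀ {x y} → y < n → x ≡ y → depth G x ≤ L
    bound y<n refl = depth-bound P y<n
    at-U : arrs s leftA (vars s leafV) ≡ U i
    at-U = trans (cong (arrs s leftA) leaf≡) left≡

  record Draining (m : ℕ) (s : State) : Set where
    field
      loaded : Loaded s
      counter≡ : vars s counterV ≡ m
      halved : ∀ {i} → i < k + k → arrs s halfA i ≡ ⌊ i /2⌋
      won : ∀ {j} → 0 < j → j < k → Won (nums s treeQ) j
      {ghost} : Ghost
      progress : Progress m (arrs s parentA) (arrs s flipA) (arrs s sizeA) (nums s treeQ) ghost

  record Drained (s : State) : Set where
    field
      loaded : Loaded s
      {ghost} : Ghost
      progress : Progress 0 (arrs s parentA) (arrs s flipA) (arrs s sizeA) (nums s treeQ) ghost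

  drain-runs : ∀ {s} → Built s → Runs drain s (drainTime k L) Drained
  drain-runs {s} st = (counterV ≔ var kV) ▸ map-post finish (loop Draining stop step start)
    where
    b : Test
    b = neg (var counterV ≐ lit 0)
    start : Draining k (exec (counterV ≔ var kV) s)
    start = record
      { loaded = record { k≡ = Ld.k≡ ; lefts = Ld.lefts ; rights = Ld.rights ; zero≡ = Ld.zero≡ }
      ; counter≡ = Ld.k≡ ; halved = B.halved ; won = B.won
      ; ghost = singletons
      ; progress = record
        { forest = singletons′ B.parent≡ B.flip≡ B.size≡
        ; leaf = inj₁ ∘ B.leaves
        ; forced = λ _ β _ x → sym (xor-identityʳ (β x))
        ; remaining = sumTo≤ k (λ i → positive≤1 (nums s treeQ (k + i)))
        ; budget = ≤-reflexive (cong (_+ k) (sumTo-zero n (λ i _ → cong (λ f → f i) B.size≡))) } }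
      where
      module B = Built st
      module Ld = Loaded B.loaded
      singletons′ : ∀ {p f z} → p ≡ (λ _ → 0) → f ≡ (λ _ → 0) → z ≡ (λ _ → 0) → Forest n p f z singletons
      singletons′ refl refl refl = forest-singletons n
    stop : ∀ {s} → Draining 0 s → tval b s ≡ true → ⊥
    stop {s} d eq = does-false (vars s counterV ≟ 0) (not-true eq) (Draining.counter≡ d)
    step : ∀ {m s} → Draining (suc m) s → tval b s ≡ true → Runs drain-step s (duration drain-stepTime L) (Draining m)
    step {m} {s} d _ =
      descend-runs Ld.k≡ 0<k D.won then λ
        { (state v₁ _ _) (descended refl refl k₁ c₁ i i<k leaf₁ top≡) →
          let half-leaf = D.halved (subst (_< k + k) (sym leaf₁) (+-monoʳ-< k i<k))
              leaf≥k    = subst (k ≤_) (sym leaf₁) (m≤m+n k i) in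
      erase ▸ (ascend-runs D.halved
          (subst (_< k) (sym half-leaf) (half-< (subst (_< k + k) (sym leaf₁) (+-monoʳ-< k i<k))))
          -- The erased cell is a leaf, so among the inner nodes only its parent can lose its
          -- equation.
          (λ {j} 0<j j<k neq → won-elsewhere T {v₁ leafV} {j} (nums s zeroQ 0) (D.won 0<j j<k)
             (<⇒≢ (<-≤-trans j<k leaf≥k)) (λ e → neq (trans e (sym half-leaf)))) then λ
        { (state v₂ _ q₂) (ascended refl k₂ c₂ leaf₂ zero₂ leaves won) →
      -- `Progress` still describes the tree `T` before the extraction; the memory already holds the
      -- repaired tree.
      process-runs {T = T} D.progress i<k
          (λ {j} j<k → ℚₚ.≤-trans (winner-top D.won (k + j) (≤-trans 0<k (m≤m+n k j)) (+-monoʳ-< k j<k))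
                                  (ℚₚ.≤-reflexive (sym top≡)))
          (trans (leaves i) (trans (cong (update T (v₁ leafV) (nums s zeroQ 0)) (sym leaf₁))
            (trans (update-same T (v₁ leafV) (nums s zeroQ 0)) (cong (λ f → f 0) Ld.zero≡))))
          (λ {j} j<k j≢i → trans (leaves j) (update-other T {v₁ leafV} (nums s zeroQ 0)
            (λ e → j≢i (+-cancelˡ-≡ k j i (trans e leaf₁)))))
          (trans leaf₂ leaf₁) (Ld.lefts i<k) (Ld.rights i<k) then λ
        { s₃ r → block (counterV ≔ var counterV ⊖ lit 1) record
        { loaded = record
          { k≡ = trans (Processed.k≡ r) (trans k₂ (trans k₁ Ld.k≡))
          ; lefts = λ {j} j<k → trans (cong (λ f → f (k + j)) (Processed.left≡ r)) (Ld.lefts j<k)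
          ; rights = λ {j} j<k → trans (cong (λ f → f (k + j)) (Processed.right≡ r)) (Ld.rights j<k)
          ; zero≡ = trans (cong (λ f → f zeroQ) (Processed.nums≡ r)) (trans zero₂ Ld.zero≡) }
        ; counter≡ = cong (_∸ 1) (trans (Processed.counter≡ r) (trans c₂ (trans c₁ D.counter≡)))
        ; halved = λ {j} j<2k → trans (cong (λ f → f j) (Processed.half≡ r)) (D.halved j<2k)
        ; won = λ {j} 0<j j<k → subst (λ q → Won (q treeQ) j) (sym (Processed.nums≡ r)) (won 0<j j<k)
        ; progress = subst
            (λ q → Progress m (arrs s₃ parentA) (arrs s₃ flipA) (arrs s₃ sizeA) (q treeQ) (Processed.ghost r))
            (sym (Processed.nums≡ r)) (Processed.progress r) } } }) }
      where
      module D = Draining d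
      module Ld = Loaded D.loaded
      T : ℕ → ℚ
      T = nums s treeQ
      0<k : 0 < k
      -- The budget has room for the `suc m` rounds to come, so k is positive.
      0<k = ≤-trans (s≤s z≤n) (≤-trans (m≤n+m (suc m) _) (Progress.budget D.progress))
    finish : ∀ {s′} → tval b s′ ≡ false × ∃[ m ] Draining m s′ → Drained s′
    finish {s′} (eq , m , d) = record
      { loaded = D.loaded
      ; progress = subst (λ m → Progress m (arrs s′ parentA) (arrs s′ flipA) (arrs s′ sizeA) (nums s′ treeQ) D.ghost)
          (trans (sym D.counter≡) (does-true (vars s′ counterV ≟ 0) (not-false eq))) D.progress }
      where module D = Draining d

  -- Painting the jobs

  Shows : (ℕ → ℕ) → Ghost → ℕ → Set
  Shows out G x = out x ≡ bit (hue G x)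

  -- A job in several scenarios is painted repeatedly, but always with its own hue.
  shows-kept : ∀ out {G x y b} → Shows out G x → b ≡ bit (hue G y) → Shows (update out y b) G x
  shows-kept out {G} {x} {y} {b} h refl with x ≟ y
  ... | yes refl = update-same out y b
  ... | no x≢y   = trans (update-other out b x≢y) h

  shows-new : ∀ out {G x y b} → y ≡ x → b ≡ bit (hue G y) → Shows (update out y b) G x
  shows-new out {y = y} {b} refl refl = update-same out y b

  record Painting (G : Ghost) (m : ℕ) (s : State) : Set where
    field
      loaded : Loaded s
      {i} : ℕ
      leaf≡ : vars s leafV ≡ k + i
      total : i + m ≡ k
      forest : Forest n (arrs s parentA) (arrs s flipA) (arrs s sizeA) G
      shown : ∀ {j} → j < i → Shows (arrs s outA) G (U j) × Shows (arrs s outA) G (V j)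

  paint-runs : ∀ {s G} → Loaded s → Forest n (arrs s parentA) (arrs s flipA) (arrs s sizeA) G →
               (∀ {x} → x < n → depth G x ≤ L) →
               Runs paint s (paintTime k L) (λ s′ → ∀ j → j < k → Shows (arrs s′ outA) G (U j) × Shows (arrs s′ outA) G (V j))
  paint-runs {s} {G} ld F shallow = (leafV ≔ var kV) ▸ map-post finish (loop (Painting G) stop step start)
    where
    start : Painting G k (exec (leafV ≔ var kV) s)
    start = record
      { loaded = record { k≡ = Ld.k≡ ; lefts = Ld.lefts ; rights = Ld.rights ; zero≡ = Ld.zero≡ }
      ; i = 0 ; leaf≡ = trans Ld.k≡ (sym (+-identityʳ k)) ; total = refl ; forest = F ; shown = λ () }
      where module Ld = Loaded ld
    stop : ∀ {s} → Painting G 0 s → tval leaves-left s ≡ true → ⊥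
    stop {s} p eq = <-irrefl (trans (sym (+-identityʳ _)) P.total) (more-leaves {s} (Loaded.k≡ P.loaded) P.leaf≡ eq)
      where module P = Painting p
    finish : ∀ {s′} → tval leaves-left s′ ≡ false × ∃[ m ] Painting G m s′ →
             ∀ j → j < k → Shows (arrs s′ outA) G (U j) × Shows (arrs s′ outA) G (V j)
    finish {s′} (eq , _ , p) j j<k =
      P.shown (subst (_ <_) (sym (no-more-leaves {s′} (Loaded.k≡ P.loaded) P.leaf≡ P.total eq)) j<k)
      where module P = Painting p
    bound : ∀ {x y} → y < n → x ≡ y → depth G x ≤ L
    bound y<n refl = shallow y<n
    step : ∀ {m s} → Painting G (suc m) s → tval leaves-left s ≡ true → Runs paint-step s (duration paint-stepTime L) (Painting G m)
    step {m} {s} p eq =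
      go-left ▸ (find-runs {L = L} P.forest (bound (U<n i<k) at-U) then λ
        { (state v₁ _ _) (found refl refl n₁ p₁ k₁ f₁) →
          let left₁ = cong (arrs s leftA) (f₁ 0)
              at-V  = trans (cong (arrs s rightA) (trans (f₁ 0) P.leaf≡)) (Ld.rights i<k) in
      paint-left ▸ (find-runs {L = L} P.forest (bound (V<n i<k) at-V) then λ
        { (state v₂ _ _) (found refl refl n₂ p₂ k₂ f₂) →
          let right₂ = cong (arrs s rightA) (f₂ 0)
              show-U = trans p₁ (cong (bit ∘ hue G) (sym left₁))
              show-V = trans p₂ (cong (bit ∘ hue G) (sym right₂))
              out₁ = update (arrs s outA) (arrs s leftA (v₁ leafV)) (v₁ parityV)
              out₂ = update out₁ (arrs s rightA (v₂ leafV)) (v₂ parityV)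
              keep : ∀ {x} → Shows (arrs s outA) G x → Shows out₁ G x
              keep h = shows-kept (arrs s outA) {G} {y = arrs s leftA (v₁ leafV)} h show-U
              keep₂ : ∀ {x} → Shows out₁ G x → Shows out₂ G x
              keep₂ h = shows-kept out₁ {G} {y = arrs s rightA (v₂ leafV)} h show-V in
      block paint-right record
        { loaded = record { k≡ = trans k₂ (trans k₁ Ld.k≡) ; lefts = Ld.lefts ; rights = Ld.rights ; zero≡ = Ld.zero≡ }
        ; i = suc P.i
        ; leaf≡ = trans (cong suc (trans (f₂ 0) (trans (f₁ 0) P.leaf≡))) (sym (+-suc k P.i))
        ; total = trans (sym (+-suc P.i m)) P.total
        ; forest = P.forest
        ; shown = λ {j} j<1+i → shown′ {Q = λ j → Shows out₂ G (U j) × Shows out₂ G (V j)}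
            (λ j<i → keep₂ (keep (proj₁ (P.shown j<i))) , keep₂ (keep (proj₂ (P.shown j<i))))
            ( keep₂ (shows-new (arrs s outA) {G} (trans left₁ at-U) show-U)
            , shows-new out₁ {G} (trans right₂ at-V) show-V )
            (m<1+n⇒m<n∨m≡n j<1+i) } }) })
      where
      module P = Painting p
      module Ld = Loaded P.loaded
      i<k : P.i < k
      i<k = more-leaves {s} Ld.k≡ P.leaf≡ eq
      at-U : arrs s leftA (vars s leafV) ≡ U P.i
      at-U = trans (cong (arrs s leftA) P.leaf≡) (Ld.lefts i<k)
      shown′ : ∀ {j} {Q : ℕ → Set} → (j < P.i → Q j) → Q P.i → j < P.i ⊎ j ≡ P.i → Q j
      shown′ below here (inj₁ j<i)  = below j<i
      shown′ below here (inj₂ refl) = here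

  record Solved (s : State) : Set where
    field
      colour : ℕ → Bool
      shown : ∀ i → i < k → arrs s outA (U i) ≡ bit (colour (U i)) × arrs s outA (V i) ≡ bit (colour (V i))
      optimal : ∀ {i} → i < k → weight i ℚ.≤ 0ℚ ⊎
                (colour (U i) ≡ colour (V i) → ∀ β → ¬ Separates β (weight i))

  kruskal-runs : ∀ {s} → Start s → Runs kruskal s (kruskalTime k L) Solved
  kruskal-runs st =
    fill-runs st then λ _ f →
    build-runs f then λ _ b →
    drain-runs b then λ _ d →
    map-post (λ shown → record
      { colour = hue (Drained.ghost d)
      ; shown = shown
      ; optimal = optimal (Drained.progress d) })
    (paint-runs (Drained.loaded d) (Progress.forest (Drained.progress d)) (depth-bound (Drained.progress d)))
    where
    optimal : ∀ {parent flip size T G} → Progress 0 parent flip size T G → ∀ {i} → i < k →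
              weight i ℚ.≤ 0ℚ ⊎ (hue G (U i) ≡ hue G (V i) → ∀ β → ¬ Separates β (weight i))
    optimal P {i} i<k with Progress.leaf P i<k
    ... | inj₂ (_ , _ , s) = inj₂ s
    ... | inj₁ eq = inj₁ (ℚₚ.≤-trans (ℚₚ.≤-reflexive (sym eq))
      (positive-0 (n≤0⇒n≡0 (≤-trans (term≤sumTo k i<k) (Progress.remaining P)))))

-- Running time

-- A factor h on the number of iterations and a factor g on the body pull out of the product; being
-- at least 1, they also absorb the cost of the tests.
loopTime-scale : ∀ b {m m′ h T T′ g} → m ≤ m′ * h → T ≤ T′ * g → 1 ≤ h → 1 ≤ g →
                 loopTime b m T ≤ loopTime b m′ T′ * (h * g)
loopTime-scale b {m} {m′} {h} {T} {T′} {g} m≤ T≤ 1≤h 1≤g = begin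
  m * (t + T) + t                             ≤⟨ +-mono-≤ (*-mono-≤ m≤ iteration≤) (m≤m*n t (h * g)) ⟩
  m′ * h * ((t + T′) * g) + t * (h * g)       ≡⟨ cong (_+ t * (h * g)) ([m*n]*[o*p]≡[m*o]*[n*p] m′ h (t + T′) g) ⟩
  m′ * (t + T′) * (h * g) + t * (h * g)       ≡⟨ *-distribʳ-+ (h * g) (m′ * (t + T′)) t ⟨
  (m′ * (t + T′) + t) * (h * g)               ∎
  where
  open ≤-Reasoning
  instance
    h≢0 : NonZero h
    h≢0 = >-nonZero 1≤h
    g≢0 : NonZero g
    g≢0 = >-nonZero 1≤g
    hg≢0 : NonZero (h * g)
    hg≢0 = m*n≢0 h g
  t : ℕ
  t = tcost b
  iteration≤ : t + T ≤ (t + T′) * g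
  iteration≤ = ≤-trans (+-mono-≤ (m≤m*n t g) T≤) (≤-reflexive (sym (*-distribʳ-+ g t T′)))

module _ {g : ℕ} (1≤g : 1 ≤ g) where

  private instance
    g≢0 : NonZero g
    g≢0 = >-nonZero 1≤g

  constant-scale : ∀ a → a ≤ a * g
  constant-scale a = m≤m*n a g

  sum-scale : ∀ {a b} a′ b′ → a ≤ a′ * g → b ≤ b′ * g → a + b ≤ (a′ + b′) * g
  sum-scale a′ b′ a≤ b≤ = ≤-trans (+-mono-≤ a≤ b≤) (≤-reflexive (sym (*-distribʳ-+ g a′ b′)))

  duration-scale : ∀ T {L} → L ≤ 3 * g → duration T L ≤ duration T 3 * g
  duration-scale (fixed a)      L≤ = constant-scale a
  duration-scale (T ∔ U)        L≤ = sum-scale (duration T 3) (duration U 3) (duration-scale T L≤) (duration-scale U L≤)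
  duration-scale (repeated b T) {L} L≤ = subst (λ h → loopTime b L T ≤ loopTime b 3 T * h) (*-identityʳ g)
    (loopTime-scale b {L} {3} {g} {T} {T} {1} L≤ (≤-reflexive (sym (*-identityʳ T))) 1≤g ≤-refl)

-- The constant is the time bound itself, evaluated at one edge and inner loops of three iterations.
kruskalTime-scale : ∀ {k L g} → 1 ≤ k → 1 ≤ g → L ≤ 3 * g → kruskalTime k L ≤ kruskalTime 1 3 * (k * g)
kruskalTime-scale {k} {L} {g} 1≤k 1≤g L≤ =
  sum-scale 1≤kg (fillTime 1) (buildTime 1 + (drainTime 1 3 + paintTime 1 3))
    (phase (cost (leafV ≔ var kV)) leaves-left (cost fill-step) (cost fill-step)
      (constant-scale 1≤g (cost fill-step)))
  (sum-scale 1≤kg (buildTime 1) (drainTime 1 3 + paintTime 1 3)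
    (phase (cost (leafV ≔ var kV ⊖ lit 1)) (neg (var leafV ≐ lit 0)) build-stepTime build-stepTime
      (constant-scale 1≤g build-stepTime))
  (sum-scale 1≤kg (drainTime 1 3) (paintTime 1 3)
    (phase (cost (counterV ≔ var kV)) (neg (var counterV ≐ lit 0)) (duration drain-stepTime L) (duration drain-stepTime 3)
      (duration-scale 1≤g drain-stepTime L≤))
    (phase (cost (leafV ≔ var kV)) leaves-left (duration paint-stepTime L) (duration paint-stepTime 3)
      (duration-scale 1≤g paint-stepTime L≤))))
  where
  1≤kg : 1 ≤ k * g
  1≤kg = *-mono-≤ 1≤k 1≤g
  phase : ∀ a b T T′ → T ≤ T′ * g → a + loopTime b k T ≤ (a + loopTime b 1 T′) * (k * g)
  phase a b T T′ T≤ = sum-scale 1≤kg a (loopTime b 1 T′) (constant-scale 1≤kg a)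
    (loopTime-scale b {k} {1} {k} {T} {T′} {g} (≤-reflexive (sym (*-identityˡ k))) T≤ 1≤k 1≤g)

n<2^[1+⌊log₂n⌋] : ∀ n → n < 2 ^ suc ⌊log₂ n ⌋
n<2^[1+⌊log₂n⌋] n = ≰⇒> λ 2^≤n →
  1+n≰n (≤-trans (≤-reflexive (sym (⌊log₂[2^n]⌋≡n (suc ⌊log₂ n ⌋)))) (⌊log₂⌋-mono-≤ 2^≤n))

-- Scenarios of size two

∑ : ∀ {n} → (Fin n → ℚ) → ℚ
∑ = sum ℚₚ.+-0-commutativeMonoid

-- Structural recursion on the vector replaces filtering of all indices, so that sums and sizes can
-- be computed by the same induction.
members : ∀ {n} → Subset n → List (Fin n)
members []          = []
members (true  ∷ S) = zero ∷ List.map suc (members S)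
members (false ∷ S) = List.map suc (members S)

-- The general `f` is needed for the induction: the tail of `tabulate f` is `tabulate (f ∘ suc)`.
filter-suc : ∀ {m n} (f : Fin m → Fin n) b (S : Subset n) →
             List.filter (_∈? (b ∷ S)) (List.tabulate (suc ∘ f)) ≡
             List.map suc (List.filter (_∈? S) (List.tabulate f))
filter-suc {zero}  f b S = refl
filter-suc {suc m} f b S with does (f zero ∈? S)
... | true  = cong (suc (f zero) ∷_) (filter-suc (f ∘ suc) b S)
... | false = filter-suc (f ∘ suc) b S

filter-members : ∀ {n} (S : Subset n) → List.filter (_∈? S) (List.allFin n) ≡ members S
filter-members []          = refl
filter-members (true  ∷ S) = cong (zero ∷_) (trans (filter-suc (λ i → i) true S) (cong (List.map suc) (filter-members S)))
filter-members (false ∷ S) = trans (filter-suc (λ i → i) false S) (cong (List.map suc) (filter-members S))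

length-members : ∀ {n} (S : Subset n) → length (members S) ≡ ∣ S ∣
length-members []          = refl
length-members (true  ∷ S) = cong suc (trans (Listₚ.length-map suc (members S)) (length-members S))
length-members (false ∷ S) = trans (Listₚ.length-map suc (members S)) (length-members S)

total : ∀ {X : Set} → (X → ℚ) → List X → ℚ
total f []       = 0ℚ
total f (x ∷ xs) = f x ℚ.+ total f xs

total-map : ∀ {X Y : Set} (f : Y → ℚ) (g : X → Y) xs → total f (List.map g xs) ≡ total (f ∘ g) xs
total-map f g []       = refl
total-map f g (x ∷ xs) = cong (f (g x) ℚ.+_) (total-map f g xs)

∑-members : ∀ {n} (S : Subset n) (f : Fin n → ℚ) →
            ∑ (λ j → if lookup S j then f j else 0ℚ) ≡ total f (members S)
∑-members []          f = refl
∑-members (true ∷ S)  f = cong (f zero ℚ.+_) (trans (∑-members S (f ∘ suc)) (sym (total-map f suc (members S))))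
∑-members (false ∷ S) f = trans (ℚₚ.+-identityˡ (∑ (λ j → if lookup S j then f (suc j) else 0ℚ)))
  (trans (∑-members S (f ∘ suc)) (sym (total-map f suc (members S))))

-- `∑-pair` expresses that x and y make up S; quantifying over f allows times masked by a partition.
record Pair {n : ℕ} (S : Subset n) (u v : ℕ) : Set where
  field
    x y : Fin n
    x≡ : toℕ x ≡ u
    y≡ : toℕ y ≡ v
    ∑-pair : ∀ (f : Fin n → ℚ) → ∑ (λ j → if lookup S j then f j else 0ℚ) ≡ f x ℚ.+ f y

pairs : ∀ {n} (Ss : List (Subset n)) → All (λ S → ∣ S ∣ ≡ 2) Ss → ∀ {i} → i < length Ss →
        Pair (nth ⊥ˢ Ss i) (nth 0 (listing Ss) (1 + i * 3)) (nth 0 (listing Ss) (2 + i * 3))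
pairs (S ∷ Ss) (size≡ ∷ sizes≡) {i} i< with members S in eq | trans (length-members S) size≡
... | x ∷ y ∷ [] | refl rewrite trans (filter-members S) eq with i | i<
-- The first scenario fills exactly three cells, so the index reduces to the corresponding one in
-- the tail.
...   | suc i | s≤s i<′ = pairs Ss sizes≡ i<′
...   | zero  | _ = record
  { x = x ; y = y ; x≡ = refl ; y≡ = refl
  ; ∑-pair = λ f → trans (∑-members S f)
      (trans (cong (total f) eq) (cong (f x ℚ.+_) (ℚₚ.+-identityʳ (f y)))) }

nth-tabulate : ∀ {X : Set} {d : X} {n} (f : Fin n → X) j → nth d (List.tabulate f) (toℕ j) ≡ f j
nth-tabulate f zero    = refl
nth-tabulate f (suc j) = nth-tabulate (f ∘ suc) j

nth-tabulate-≥0 : ∀ {n} (f : Fin n → ℚ) → (∀ j → 0ℚ ℚ.≤ f j) → ∀ i → 0ℚ ℚ.≤ nth 0ℚ (List.tabulate f) i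
nth-tabulate-≥0 {zero}  f f≥0 i       = ℚₚ.≤-refl
nth-tabulate-≥0 {suc n} f f≥0 zero    = f≥0 zero
nth-tabulate-≥0 {suc n} f f≥0 (suc i) = nth-tabulate-≥0 (f ∘ suc) (f≥0 ∘ suc) i

module _ {X : Set} (f : X → ℚ) (d : X) where

  maximum-upper : ∀ xs {i} → i < length xs → f (nth d xs i) ℚ.≤ List.foldr _⊔_ 0ℚ (List.map f xs)
  maximum-upper (x ∷ xs) {zero}  _        = ℚₚ.p≤p⊔q (f x) _
  maximum-upper (x ∷ xs) {suc i} (s≤s i<) = ℚₚ.≤-trans (maximum-upper xs i<) (ℚₚ.p≤q⊔p (f x) _)

  maximum-least : ∀ xs {M} → 0ℚ ℚ.≤ M → (∀ {i} → i < length xs → f (nth d xs i) ℚ.≤ M) →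
                  List.foldr _⊔_ 0ℚ (List.map f xs) ℚ.≤ M
  maximum-least []       0≤M f≤M = 0≤M
  maximum-least (x ∷ xs) 0≤M f≤M = ℚₚ.⊔-lub (f≤M (s≤s z≤n)) (maximum-least xs 0≤M (f≤M ∘ s≤s))

  maximum≥0 : ∀ xs → 0ℚ ℚ.≤ List.foldr _⊔_ 0ℚ (List.map f xs)
  maximum≥0 []       = ℚₚ.≤-refl
  maximum≥0 (x ∷ xs) = ℚₚ.≤-trans (maximum≥0 xs) (ℚₚ.p≤q⊔p (f x) _)

-- The makespan of two jobs with processing times p and q, where a and b
-- tell which of them run on machine 1.
pair-makespan : ℚ → ℚ → Bool → Bool → ℚ
pair-makespan p q a b =
  ((if a then p else 0ℚ) ℚ.+ (if b then q else 0ℚ)) ⊔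
  ((if not a then p else 0ℚ) ℚ.+ (if not b then q else 0ℚ))

module _ {p q : ℚ} (p≥0 : 0ℚ ℚ.≤ p) (q≥0 : 0ℚ ℚ.≤ q) where

  p≤p+q : p ℚ.≤ p ℚ.+ q
  p≤p+q = ℚₚ.≤-trans (ℚₚ.≤-reflexive (sym (ℚₚ.+-identityʳ p))) (ℚₚ.+-monoʳ-≤ p q≥0)

  q≤p+q : q ℚ.≤ p ℚ.+ q
  q≤p+q = ℚₚ.≤-trans (ℚₚ.≤-reflexive (sym (ℚₚ.+-identityˡ q))) (ℚₚ.+-monoˡ-≤ q p≥0)

  pair-together : ∀ {a b} → a ≡ b → p ℚ.+ q ℚ.≤ pair-makespan p q a b
  pair-together {true}  refl = ℚₚ.p≤p⊔q (p ℚ.+ q) _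
  pair-together {false} refl = ℚₚ.p≤q⊔p (0ℚ ℚ.+ 0ℚ) (p ℚ.+ q)

  pair-first : ∀ a b → p ℚ.≤ pair-makespan p q a b
  pair-first true  true  = ℚₚ.≤-trans p≤p+q (pair-together {true} refl)
  pair-first false false = ℚₚ.≤-trans p≤p+q (pair-together {false} refl)
  pair-first true  false = ℚₚ.≤-trans (ℚₚ.≤-reflexive (sym (ℚₚ.+-identityʳ p))) (ℚₚ.p≤p⊔q (p ℚ.+ 0ℚ) (0ℚ ℚ.+ q))
  pair-first false true  = ℚₚ.≤-trans (ℚₚ.≤-reflexive (sym (ℚₚ.+-identityʳ p))) (ℚₚ.p≤q⊔p (0ℚ ℚ.+ q) (p ℚ.+ 0ℚ))

  pair-second : ∀ a b → q ℚ.≤ pair-makespan p q a b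
  pair-second true  true  = ℚₚ.≤-trans q≤p+q (pair-together {true} refl)
  pair-second false false = ℚₚ.≤-trans q≤p+q (pair-together {false} refl)
  pair-second true  false = ℚₚ.≤-trans (ℚₚ.≤-reflexive (sym (ℚₚ.+-identityˡ q))) (ℚₚ.p≤q⊔p (p ℚ.+ 0ℚ) (0ℚ ℚ.+ q))
  pair-second false true  = ℚₚ.≤-trans (ℚₚ.≤-reflexive (sym (ℚₚ.+-identityˡ q))) (ℚₚ.p≤p⊔q (0ℚ ℚ.+ q) (p ℚ.+ 0ℚ))

  pair-least : ∀ {a b M} → 0ℚ ℚ.≤ M → p ℚ.≤ M → q ℚ.≤ M → (a ≡ b → p ℚ.+ q ℚ.≤ M) → pair-makespan p q a b ℚ.≤ M
  pair-least {true}  {true}  0≤ p≤ q≤ pq≤ = ℚₚ.⊔-lub (pq≤ refl) (ℚₚ.≤-trans (ℚₚ.≤-reflexive (ℚₚ.+-identityʳ 0ℚ)) 0≤)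
  pair-least {false} {false} 0≤ p≤ q≤ pq≤ = ℚₚ.⊔-lub (ℚₚ.≤-trans (ℚₚ.≤-reflexive (ℚₚ.+-identityʳ 0ℚ)) 0≤) (pq≤ refl)
  pair-least {true}  {false} 0≤ p≤ q≤ pq≤ = ℚₚ.⊔-lub (ℚₚ.≤-trans (ℚₚ.≤-reflexive (ℚₚ.+-identityʳ p)) p≤)
                                                     (ℚₚ.≤-trans (ℚₚ.≤-reflexive (ℚₚ.+-identityˡ q)) q≤)
  pair-least {false} {true}  0≤ p≤ q≤ pq≤ = ℚₚ.⊔-lub (ℚₚ.≤-trans (ℚₚ.≤-reflexive (ℚₚ.+-identityˡ q)) q≤)
                                                     (ℚₚ.≤-trans (ℚₚ.≤-reflexive (ℚₚ.+-identityʳ p)) p≤)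

-- From the colouring to an optimal partition

module Solve (I : Instance) (sizes≡ : All (λ S → ∣ S ∣ ≡ 2) (scenarios I)) where

  k L : ℕ
  k = length (scenarios I)
  -- One successor makes up for rounding the logarithm down, the other for the tree having 2k cells.
  L = suc (suc ⌊log₂ k ⌋)

  time : ℕ → ℚ
  time = nth 0ℚ (List.tabulate (p I))

  scenario : ℕ → Subset (n I)
  scenario = nth ⊥ˢ (scenarios I)

  module E {i} (i<k : i < k) = Pair (pairs (scenarios I) sizes≡ i<k)

  listed< : ∀ {x : Fin (n I)} {u} → toℕ x ≡ u → u < n I
  listed< {x} refl = toℕ<n x

  k<2^[1+log] : k < 2 ^ suc ⌊log₂ k ⌋
  k<2^[1+log] = n<2^[1+⌊log₂n⌋] k

  k+k≤2^L : k + k ≤ 2 ^ L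
  k+k≤2^L = +-mono-≤ (<⇒≤ k<2^[1+log]) (≤-trans (<⇒≤ k<2^[1+log]) (≤-reflexive (sym (+-identityʳ _))))

  k<2^L : k < 2 ^ L
  k<2^L = <-≤-trans k<2^[1+log] (^-monoʳ-≤ 2 (n≤1+n (suc ⌊log₂ k ⌋)))

  open Kruskal (n I) k L (nth 0 (listing (scenarios I))) time
    (λ i<k → listed< (E.x≡ i<k)) (λ i<k → listed< (E.y≡ i<k))
    (nth-tabulate-≥0 (p I) (p≥0 I)) k+k≤2^L k<2^L public

  start : Start (input I)
  start = record
    { k≡ = refl ; counter≡ = refl ; list≡ = refl ; time≡ = refl ; half≡ = refl
    ; parent≡ = refl ; flip≡ = refl ; size≡ = refl ; zero≡ = refl }

  scenario-makespan : Subset (n I) → Subset (n I) → ℚ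
  scenario-makespan A S = load I (A ∩ S) ⊔ load I (∁ A ∩ S)

  module _ {i : ℕ} (i<k : i < k) where

    open E i<k

    -- Masking by the intersection is masking by the scenario of times already masked by A, to which
    -- `∑-pair` applies.
    load-pair : ∀ A → load I (A ∩ scenario i) ≡
                (if lookup A x then p I x else 0ℚ) ℚ.+ (if lookup A y then p I y else 0ℚ)
    load-pair A = trans (sum-cong-≗ ℚₚ.+-0-commutativeMonoid rearrange) (∑-pair (λ j → if lookup A j then p I j else 0ℚ))
      where
      swap : ∀ a b {q : ℚ} → (if a ∧ b then q else 0ℚ) ≡ (if b then (if a then q else 0ℚ) else 0ℚ)
      swap true  true  = refl
      swap true  false = refl
      swap false true  = refl
      swap false false = refl
      rearrange : ∀ j → (if lookup (A ∩ scenario i) j then p I j else 0ℚ) ≡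
                        (if lookup (scenario i) j then (if lookup A j then p I j else 0ℚ) else 0ℚ)
      rearrange j = trans (cong (if_then p I j else 0ℚ) (lookup-zipWith _∧_ j A (scenario i)))
                          (swap (lookup A j) (lookup (scenario i) j))

    scenario-pair : ∀ A → scenario-makespan A (scenario i) ≡ pair-makespan (p I x) (p I y) (lookup A x) (lookup A y)
    scenario-pair A = cong₂ _⊔_ (load-pair A) (trans (load-pair (∁ A))
      (cong₂ (λ a b → (if a then p I x else 0ℚ) ℚ.+ (if b then p I y else 0ℚ)) (lookup-map x not A) (lookup-map y not A)))

    weight≡ : weight i ≡ p I x ℚ.+ p I y
    weight≡ = cong₂ ℚ._+_ (trans (cong time (sym x≡)) (nth-tabulate (p I) x))
                          (trans (cong time (sym y≡)) (nth-tabulate (p I) y))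

    pair≤makespan : ∀ B → pair-makespan (p I x) (p I y) (lookup B x) (lookup B y) ℚ.≤ makespan I B
    pair≤makespan B = ℚₚ.≤-trans (ℚₚ.≤-reflexive (sym (scenario-pair B)))
      (maximum-upper (scenario-makespan B) ⊥ˢ (scenarios I) i<k)

    first≤makespan : ∀ B → p I x ℚ.≤ makespan I B
    first≤makespan B = ℚₚ.≤-trans (pair-first (p≥0 I x) (p≥0 I y) (lookup B x) (lookup B y)) (pair≤makespan B)

    second≤makespan : ∀ B → p I y ℚ.≤ makespan I B
    second≤makespan B = ℚₚ.≤-trans (pair-second (p≥0 I x) (p≥0 I y) (lookup B x) (lookup B y)) (pair≤makespan B)

  -- A partition as a colouring of all naturals; endpoints of edges are below n, where the default
  -- does not interfere.
  side : Subset (n I) → ℕ → Bool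
  side B = nth false (List.tabulate (lookup B))

  together≤makespan : ∀ B {i} → i < k → side B (U i) ≡ side B (V i) → weight i ℚ.≤ makespan I B
  together≤makespan B i<k same = ℚₚ.≤-trans (ℚₚ.≤-reflexive (weight≡ i<k))
    (ℚₚ.≤-trans (pair-together (p≥0 I _) (p≥0 I _)
        (trans (sym (at-side x≡)) (trans same (at-side y≡))))
      (pair≤makespan i<k B))
    where
    open E i<k
    at-side : ∀ {j : Fin (n I)} {u} → toℕ j ≡ u → side B u ≡ lookup B j
    at-side {j} refl = nth-tabulate (lookup B) j

  open Edges (n I) k U V weight (λ i<k → listed< (E.x≡ i<k)) (λ i<k → listed< (E.y≡ i<k)) weight≥0 using (Separates)

  -- A partition of makespan below θ would separate every edge of weight at least θ, as an edge on
  -- one machine contributes its full weight.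
  inseparable≤makespan : ∀ B {θ} → (∀ β → ¬ Separates β θ) → θ ℚ.≤ makespan I B
  inseparable≤makespan B {θ} inseparable = ℚₚ.≮⇒≥ λ M<θ → inseparable (side B) λ i i<k θ≤w same →
    ℚₚ.<-irrefl refl (ℚₚ.<-≤-trans M<θ (ℚₚ.≤-trans θ≤w (together≤makespan B i<k same)))

  -- Every scenario is charged to the makespan of the competitor B: a separated pair through its
  -- larger job, an unseparated one through `weight≤`.
  solved-optimal : ∀ {s} → Solved s → Optimal I (output I s)
  solved-optimal {s} solved B = maximum-least (scenario-makespan A) ⊥ˢ (scenarios I) M≥0 λ i<k →
    ℚₚ.≤-trans (ℚₚ.≤-reflexive (scenario-pair i<k A))
      (pair-least (p≥0 I _) (p≥0 I _) M≥0
        (first≤makespan i<k B) (second≤makespan i<k B)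
        (λ same → ℚₚ.≤-trans (ℚₚ.≤-reflexive (sym (weight≡ i<k))) (weight≤ i<k same)))
    where
    open Solved solved
    A : Subset (n I)
    A = output I s
    M≥0 : 0ℚ ℚ.≤ makespan I B
    M≥0 = maximum≥0 (scenario-makespan B) ⊥ˢ (scenarios I)
    does-bit : ∀ b → does (bit b ≟ 1) ≡ b
    does-bit true  = refl
    does-bit false = refl
    at-colour : ∀ {j : Fin (n I)} {u} → toℕ j ≡ u → arrs s outA u ≡ bit (colour u) → lookup A j ≡ colour u
    at-colour {j} refl shows = trans (lookup∘tabulate (λ j → does (arrs s 1 (toℕ j) ≟ 1)) j)
      (trans (cong (λ m → does (m ≟ 1)) shows) (does-bit (colour (toℕ j))))
    weight≤ : ∀ {i} (i<k : i < k) → lookup A (E.x i<k) ≡ lookup A (E.y i<k) → weight i ℚ.≤ makespan I B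
    weight≤ {i} i<k same with optimal i<k
    ... | inj₁ w≤0    = ℚₚ.≤-trans w≤0 M≥0
    ... | inj₂ closed = inseparable≤makespan B (closed
      (trans (sym (at-colour (E.x≡ i<k) (proj₁ (shown i i<k)))) (trans same (at-colour (E.y≡ i<k) (proj₂ (shown i i<k))))))

  solution : Σ[ t ∈ ℕ ] Σ[ s ∈ State ]
             ((kruskal , input I ⇓[ t ] s) × Optimal I (output I s) ×
              (2 ≤ k → t ≤ kruskalTime 1 3 * (k * ⌊log₂ k ⌋)))
  solution = Runs.time run , Runs.final run , Runs.steps run , solved-optimal (Runs.post run) , bound (Runs.within run)
    where
    run : Runs kruskal (input I) (kruskalTime k L) Solved
    run = kruskal-runs start
    2+n≤3n : ∀ {n} → 1 ≤ n → 2 + n ≤ 3 * n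
    -- Source of the 3 in the constant: the additive 2 in L is at most twice a logarithm that is at
    -- least 1.
    2+n≤3n {n} 1≤n = +-mono-≤ {1} {n} {1 + n} 1≤n (+-mono-≤ {1} {n} {n} 1≤n (≤-reflexive (sym (+-identityʳ n))))
    bound : ∀ {t} → t ≤ kruskalTime k L → 2 ≤ k → t ≤ kruskalTime 1 3 * (k * ⌊log₂ k ⌋)
    bound t≤ 2≤k = ≤-trans t≤ (kruskalTime-scale (≤-trans (s≤s z≤n) 2≤k) 1≤log (2+n≤3n 1≤log))
      where
      1≤log : 1 ≤ ⌊log₂ k ⌋
      1≤log = ⌊log₂⌋-mono-≤ 2≤k

theorem2 : Σ[ prog ∈ Program ] Σ[ c ∈ ℕ ]
    ((I : Instance) → All (λ S → ∣ S ∣ ≡ 2) (scenarios I) →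
    let k = length (scenarios I) in
    Σ[ t ∈ ℕ ] Σ[ s ∈ State ]
    ((prog , input I ⇓[ t ] s)
    × Optimal I (output I s)
    × (2 ≤ k → t ≤ c * (k * ⌊log₂ k ⌋))))
theorem2 = kruskal , kruskalTime 1 3 , Solve.solution
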